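{- Assume the explicit abc conjecture. Let $t\geq 3$ and $c>0$ be fixed positive integers. Then for every $i$ with $2\leq i\leq t$ the set $\mathcal{N}(c)_i$ is finite. Consequently the set $\mathcal{N}(c)=\bigcup_{i=2}^t\mathcal{N}(c)_i$ is finite, i.e. the equation $\prod_{l=1}^t a_l! = n_1!\,n_2!$ has only finitely many solutions $(a_1,\dots,a_t,n_1,n_2)\in\mathcal{N}(c)$.
   Context: Explicit abc conjecture: whenever $x,y,z$ are coprime nonzero integers with $x+y=z$, one has $z<N(xyz)^{7/4}$, where for a nonzero integer $a$, $N(a)=\prod_{p\mid a}p$ is the product of the distinct primes dividing $a$. Setting: consider integer tuples $(a_1,\dots,a_t,n_1,n_2)$ with $a_1\geq a_2\geq\cdots\geq a_t\geq 2$, $n_1\geq n_2\geq 2$, $a_l\neq n_j$ for all $l,j$, satisfying $\prod_{l=1}^t a_l!=n_1!\,n_2!$. Such a solution is called trivial if there is a pair $(l,j)$ with $|a_l-n_j|=1$, and nontrivial otherwise. For $2\leq i\leq t$ put $k_1=n_1-a_1$ and $k_2=n_2-a_i$, and define $\mathcal{N}(c)_i$ to be the set of nontrivial solutions with $n_1>a_1$, $n_2>a_i$ and $k_2/k_1\leq c$. -}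

module Defs where

open import Data.Nat using (ℕ; zero; suc; _+_; _*_; _∸_; _^_; _≤_; _<_; _≥_; _>_)
open import Data.Nat using (_!)
open import Data.Nat.ListAction using (product)
open import Data.Nat.Divisibility using (_∣_; _∣?_)
open import Data.Nat.Primality using (Prime; prime?)
open import Data.Nat.Coprimality using (Coprime)
open import Data.List using (List; filter; upTo)
open import Data.Product using (_×_; Σ; ∃-syntax)
open import Relation.Nullary using (¬_)
open import Relation.Nullary.Decidable using (_×-dec_)
open import Relation.Binary.PropositionalEquality using (_≡_; _≢_)
open import Data.Integer as ℤ using (ℤ; +_; ∣_∣)

-- Radical N(a) of a natural number: product of the distinct primes p ≤ a with p ∣ a.
-- (Every prime divisor of a nonzero a is ≤ a, so this is ∏_{p ∣ a} p for a ≠ 0.)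
rad : ℕ → ℕ
rad n = product (filter (λ p → prime? p ×-dec p ∣? n) (upTo (suc n)))

radℤ : ℤ → ℤ
radℤ a = + rad ∣ a ∣

-- Explicit abc conjecture: for coprime nonzero integers x, y, z with x + y = z,
-- z < N(xyz)^(7/4).  Since N(xyz) ≥ 1, for z > 0 this is z^4 < N(xyz)^7,
-- and for z ≤ 0 it holds trivially.
ExplicitABC : Set
ExplicitABC = (x y z : ℤ) → x ≢ + 0 → y ≢ + 0 → z ≢ + 0 →
  Coprime ∣ x ∣ ∣ y ∣ → x ℤ.+ y ≡ z →
  + 0 ℤ.< z → ∣ z ∣ ^ 4 < rad ∣ x ℤ.* y ℤ.* z ∣ ^ 7

prodFrom1 : ℕ → (ℕ → ℕ) → ℕ
prodFrom1 zero    f = 1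
prodFrom1 (suc t) f = prodFrom1 t f * f (suc t)

absDiff : ℕ → ℕ → ℕ
absDiff m n = (m ∸ n) + (n ∸ m)

-- The tuple (a_1,…,a_t,n_1,n_2) is given by a : ℕ → ℕ (only a 1, …, a t are relevant)
-- and n₁ n₂.  Solution of ∏ a_l! = n₁! n₂! with the standing constraints.
IsSolution : (t : ℕ) → (ℕ → ℕ) → ℕ → ℕ → Set
IsSolution t a n₁ n₂ =
  (∀ l → 1 ≤ l → l < t → a (suc l) ≤ a l) ×
  (2 ≤ a t) ×
  (n₂ ≤ n₁) × (2 ≤ n₂) ×
  (∀ l → 1 ≤ l → l ≤ t → a l ≢ n₁ × a l ≢ n₂) ×
  (prodFrom1 t (λ l → a l !) ≡ n₁ ! * n₂ !)

Nontrivial : (t : ℕ) → (ℕ → ℕ) → ℕ → ℕ → Set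
Nontrivial t a n₁ n₂ =
  ∀ l → 1 ≤ l → l ≤ t → absDiff (a l) n₁ ≢ 1 × absDiff (a l) n₂ ≢ 1

-- Membership in 𝒩(c)_i: nontrivial solution with n₁ > a₁, n₂ > a_i and
-- k₂/k₁ ≤ c where k₁ = n₁ - a₁ > 0, k₂ = n₂ - a_i, i.e. k₂ ≤ c·k₁.
InN : (c t i : ℕ) → (ℕ → ℕ) → ℕ → ℕ → Set
InN c t i a n₁ n₂ =
  IsSolution t a n₁ n₂ × Nontrivial t a n₁ n₂ ×
  (a 1 < n₁) × (a i < n₂) × (n₂ ∸ a i ≤ c * (n₁ ∸ a 1))

-- A set of tuples (a_1,…,a_t,n_1,n_2) is finite iff all its members have
-- all coordinates bounded by a common B.
BoundedBy : (t : ℕ) → ℕ → (ℕ → ℕ) → ℕ → ℕ → Set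
BoundedBy t B a n₁ n₂ = (∀ l → 1 ≤ l → l ≤ t → a l ≤ B) × n₁ ≤ B × n₂ ≤ B

{-# OPTIONS --safe #-}

-- Write n = n₁, a = a₁, k = n₁ − a₁ ≥ 2, j = n₂ − aᵢ ≤ ck, let bs be the remaining a_l and A their maximum;
-- then (a+1)⋯(a+k) · (aᵢ+1)⋯(aᵢ+j) = ∏ b!.  Comparing 2-adic valuations in the original equation gives
-- Σ b ≤ k + j + t·log n, and merging factorials under this constraint gives (a+1)⋯(a+k) ≤ A^(k + t·log n)
-- with A ≤ a and A ≤ (1+c)k + t·log n.  For large n this forces k = O(log n), and then k = O(log log n).
-- All primes dividing (a+1)⋯(a+k) are at most A, and the product of the primes up to A is at most 8^A.
-- Applying abc to the pairs (a+1, a+2), (a+3, a+4), … and bounding the common divisors by powers of k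
-- yields k·log n = O(A), whereas A! ≤ n^((1+c)k) says A·log A = O(k·log n).  Hence A, and with it n, is bounded.
module Submission where

open import Defs
open import Data.Nat
open import Data.Nat.Properties
open import Data.Nat.DivMod using (m≡m%n+[m/n]*n; m%n<n; m/n*n≤m; m/n*n≡m)
open import Data.Nat.Divisibility
open import Data.Nat.Primality using (Prime; prime?; prime[2]; euclidsLemma; prime⇒irreducible; prime⇒nonTrivial; ¬prime[1])
open import Data.Nat.GCD using (gcd; gcd[m,n]∣m; gcd[m,n]∣n; gcd-greatest; c*gcd[m,n]≡gcd[cm,cn]; gcd[m,n]≢0)
open import Data.Nat.LCM using (lcm; lcm-least; gcd*lcm)
open import Data.Nat.Combinatorics using (_C_; nCk≡n!/k![n-k]!; k![n∸k]!∣n!; nCk+nC[k+1]≡[n+1]C[k+1])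
open import Data.Nat.Coprimality using (1-coprimeTo) renaming (sym to coprime-sym)
open import Data.Nat.Induction using (<-rec)
open import Data.Nat.ListAction using (sum; product)
open import Data.Nat.ListAction.Properties using (product-↭; ∈⇒≤product)
open import Data.Nat.Tactic.RingSolver using (solve-∀)
import Data.Integer as ℤ
import Data.Integer.Properties as ℤ
open import Data.List using (List; []; _∷_; _++_; map; length; upTo)
open import Data.List.Membership.Propositional using (_∈_)
open import Data.List.Membership.Propositional.Properties using (∈-filter⁻; ∈-∃++; ∈-map⁺)
open import Data.List.Relation.Unary.Any using (here; there)
open import Data.List.Relation.Unary.All as All using (All; []; _∷_)
import Data.List.Relation.Unary.All.Properties as All
open import Data.List.Relation.Unary.AllPairs using (_∷_)
open import Data.List.Relation.Unary.Unique.Propositional using (Unique)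
import Data.List.Relation.Unary.Unique.Propositional.Properties as Unique
open import Data.List.Relation.Binary.Permutation.Propositional using (_↭_)
open import Data.List.Relation.Binary.Permutation.Propositional.Properties using (↭-length; shift; map⁺; All-resp-↭)
open import Data.Product using (_×_; _,_; ∃-syntax; proj₁; proj₂)
open import Data.Sum using (_⊎_; inj₁; inj₂)
open import Function using (_∘_)
open import Relation.Nullary using (yes; no; contradiction)
open import Relation.Nullary.Decidable using (_×-dec_)
open import Relation.Binary.PropositionalEquality using (_≡_; _≢_; refl; sym; trans; cong; cong₂; subst)
open ≤-Reasoning

-- Products of factorials

rising : ℕ → ℕ → ℕ
rising a zero    = 1
rising a (suc k) = rising a k * (a + suc k)

!*rising : ∀ a k → a ! * rising a k ≡ (a + k) !
!*rising a zero    = trans (*-identityʳ (a !)) (cong _! (sym (+-identityʳ a)))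
!*rising a (suc k) = begin-equality
  a ! * (rising a k * (a + suc k)) ≡⟨ *-assoc (a !) _ _ ⟨
  a ! * rising a k * (a + suc k)   ≡⟨ cong₂ _*_ (!*rising a k) (+-suc a k) ⟩
  (a + k) ! * suc (a + k)          ≡⟨ *-comm ((a + k) !) _ ⟩
  suc (a + k) !                    ≡⟨ cong _! (+-suc a k) ⟨
  (a + suc k) !                    ∎

rising-+ : ∀ a x y → rising a (x + y) ≡ rising a x * rising (a + x) y
rising-+ a x zero    = trans (cong (rising a) (+-identityʳ x)) (sym (*-identityʳ _))
rising-+ a x (suc y) = begin-equality
  rising a (x + suc y)                            ≡⟨ cong (rising a) (+-suc x y) ⟩
  rising a (x + y) * (a + suc (x + y))            ≡⟨ cong₂ _*_ (rising-+ a x y) (cong (a +_) (sym (+-suc x y))) ⟩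
  rising a x * rising (a + x) y * (a + (x + suc y)) ≡⟨ *-assoc (rising a x) _ _ ⟩
  rising a x * (rising (a + x) y * (a + (x + suc y))) ≡⟨ cong (λ z → rising a x * (rising (a + x) y * z)) (+-assoc a x (suc y)) ⟨
  rising a x * rising (a + x) (suc y)             ∎

suc-^≤rising : ∀ a k → suc a ^ k ≤ rising a k
suc-^≤rising a zero    = ≤-refl
suc-^≤rising a (suc k) = begin
  suc a * suc a ^ k        ≡⟨ *-comm (suc a) _ ⟩
  suc a ^ k * suc a        ≤⟨ *-mono-≤ (suc-^≤rising a k) (≤-trans (s≤s (m≤m+n a k)) (≤-reflexive (sym (+-suc a k)))) ⟩
  rising a k * (a + suc k) ∎

^≤rising : ∀ a k → a ^ k ≤ rising a k
^≤rising a k = ≤-trans (^-monoˡ-≤ k (n≤1+n a)) (suc-^≤rising a k)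

rising≤^ : ∀ a k m → a + k ≤ m → rising a k ≤ m ^ k
rising≤^ a zero    m _ = ≤-refl
rising≤^ a (suc k) m h = begin
  rising a k * (a + suc k) ≤⟨ *-mono-≤ (rising≤^ a k m (≤-trans (+-monoʳ-≤ a (n≤1+n k)) h)) h ⟩
  m ^ k * m                ≡⟨ *-comm (m ^ k) m ⟩
  m * m ^ k                ∎

!≤rising : ∀ a k → k ! ≤ rising a k
!≤rising a zero    = ≤-refl
!≤rising a (suc k) = begin
  suc k * k !              ≡⟨ *-comm (suc k) (k !) ⟩
  k ! * suc k              ≤⟨ *-mono-≤ (!≤rising a k) (m≤n+m (suc k) a) ⟩
  rising a k * (a + suc k) ∎

∣rising : ∀ a k i → 1 ≤ i → i ≤ k → a + i ∣ rising a k
∣rising a zero    i 1≤i i≤0 = contradiction (≤-trans 1≤i i≤0) λ ()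
∣rising a (suc k) i 1≤i i≤k with m≤n⇒m<n∨m≡n i≤k
... | inj₁ (s≤s i≤k′) = ∣m⇒∣m*n (a + suc k) (∣rising a k i 1≤i i≤k′)
... | inj₂ refl       = n∣m*n (rising a k)

!*!≤[+]! : ∀ m n → m ! * n ! ≤ (m + n) !
!*!≤[+]! m n = ≤-trans (*-monoʳ-≤ (m !) (!≤rising m n)) (≤-reflexive (!*rising m n))

∏! : List ℕ → ℕ
∏! bs = product (map _! bs)

-- Past `n`, the factorial `b !` has at most `q` further factors, each at most `m`.
!≤!*^ : ∀ b n m q → b ≤ m → b ≤ n + q → .{{NonZero m}} → b ! ≤ n ! * m ^ q
!≤!*^ b n m q b≤m b≤n+q with ≤-total b n
... | inj₁ b≤n = ≤-trans (∣⇒≤ {{n !≢0}} (m≤n⇒m!∣n! b≤n)) (m≤m*n (n !) (m ^ q) {{m^n≢0 m q}})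
... | inj₂ n≤b = begin
  b !                     ≡⟨ cong _! n+d ⟨
  (n + (b ∸ n)) !         ≡⟨ !*rising n (b ∸ n) ⟨
  n ! * rising n (b ∸ n)  ≤⟨ *-monoʳ-≤ (n !) (rising≤^ n (b ∸ n) m (≤-trans (≤-reflexive n+d) b≤m)) ⟩
  n ! * m ^ (b ∸ n)       ≤⟨ *-monoʳ-≤ (n !) (^-monoʳ-≤ m (m≤n+o⇒m∸n≤o b n b≤n+q)) ⟩
  n ! * m ^ q             ∎
  where n+d = m+[n∸m]≡n n≤b

-- Factorials merge by `x ! * y ! ≤ (x + y) !` while the running total stays within the budget `n`;
-- the excess consists of at most `q` factors, each at most `m`.
∏!≤!*^ : ∀ bs n m q → All (_≤ m) bs → sum bs ≤ n + q → .{{NonZero m}} → ∏! bs ≤ n ! * m ^ q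
∏!≤!*^ []       n m q _ _ = *-mono-≤ (1≤n! n) (m^n>0 m q)
∏!≤!*^ (b ∷ bs) n m q (b≤m ∷ bs≤m) Σ≤ with ≤-total b n
... | inj₁ b≤n = begin
  b ! * ∏! bs                 ≤⟨ *-monoʳ-≤ (b !) (∏!≤!*^ bs (n ∸ b) m q bs≤m Σ′) ⟩
  b ! * ((n ∸ b) ! * m ^ q)   ≡⟨ *-assoc (b !) _ _ ⟨
  b ! * (n ∸ b) ! * m ^ q     ≤⟨ *-monoˡ-≤ (m ^ q) (!*!≤[+]! b (n ∸ b)) ⟩
  (b + (n ∸ b)) ! * m ^ q     ≡⟨ cong (λ z → z ! * m ^ q) b+d ⟩
  n ! * m ^ q                 ∎
  where
  b+d = m+[n∸m]≡n b≤n
  Σ′ : sum bs ≤ n ∸ b + q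
  Σ′ = +-cancelˡ-≤ b _ _ (begin
    b + sum bs      ≤⟨ Σ≤ ⟩
    n + q           ≡⟨ cong (_+ q) b+d ⟨
    b + (n ∸ b) + q ≡⟨ +-assoc b _ q ⟩
    b + (n ∸ b + q) ∎)
-- This entry exhausts the budget: it contributes `n !` and `e` surplus factors, and the tail
-- continues with budget 0 and allowance `q ∸ e`.
... | inj₂ n≤b = begin
  b ! * ∏! bs                       ≤⟨ *-mono-≤ (!≤!*^ b n m e b≤m (≤-reflexive (sym n+e))) (∏!≤!*^ bs 0 m (q ∸ e) bs≤m Σ′) ⟩
  n ! * m ^ e * (1 * m ^ (q ∸ e))   ≡⟨ cong (n ! * m ^ e *_) (*-identityˡ _) ⟩
  n ! * m ^ e * m ^ (q ∸ e)         ≡⟨ *-assoc (n !) _ _ ⟩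
  n ! * (m ^ e * m ^ (q ∸ e))       ≡⟨ cong (n ! *_) (^-distribˡ-+-* m e (q ∸ e)) ⟨
  n ! * m ^ (e + (q ∸ e))           ≡⟨ cong (λ z → n ! * m ^ z) (m+[n∸m]≡n e≤q) ⟩
  n ! * m ^ q                       ∎
  where
  e = b ∸ n
  n+e = m+[n∸m]≡n n≤b
  Σ″ : e + sum bs ≤ q
  Σ″ = +-cancelˡ-≤ n _ _ (begin
    n + (e + sum bs) ≡⟨ +-assoc n e _ ⟨
    n + e + sum bs   ≡⟨ cong (_+ sum bs) n+e ⟩
    b + sum bs       ≤⟨ Σ≤ ⟩
    n + q            ∎)
  e≤q = ≤-trans (m≤m+n e (sum bs)) Σ″
  Σ′ : sum bs ≤ q ∸ e
  Σ′ = +-cancelˡ-≤ e _ _ (≤-trans Σ″ (≤-reflexive (sym (m+[n∸m]≡n e≤q))))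

-- 2-adic valuations of factorials

odd-* : ∀ m n → 2 ∤ m → 2 ∤ n → 2 ∤ m * n
odd-* m n p q r with euclidsLemma m n prime[2] r
... | inj₁ x = p x
... | inj₂ y = q y

2∤1 : 2 ∤ 1
2∤1 (divides zero ())
2∤1 (divides (suc q) ())

2∤suc-double : ∀ h → 2 ∤ suc (h + h)
2∤suc-double h d = 2∤1 (∣m+n∣m⇒∣n (subst (2 ∣_) (+-comm 1 (h + h)) d) (divides h (h+h≡h*2 h)))
  where
  h+h≡h*2 : ∀ h → h + h ≡ h * 2
  h+h≡h*2 = solve-∀

-- The even factors 2, 4, ..., 2h contribute `2 ^ h * h !`, and `o` collects the odd ones.
double! : ∀ h → ∃[ o ] 2 ∤ o × (h + h) ! ≡ 2 ^ h * h ! * o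
double! zero = 1 , 2∤1 , refl
double! (suc h) with o , odd , eq ← double! h =
  suc (h + h) * o , odd-* _ _ (2∤suc-double h) odd , (begin-equality
  (suc h + suc h) !                              ≡⟨ cong (λ z → suc z !) (+-suc h h) ⟩
  suc (suc (h + h)) * (suc (h + h) * (h + h) !)  ≡⟨ cong (λ z → suc (suc (h + h)) * (suc (h + h) * z)) eq ⟩
  suc (suc (h + h)) * (suc (h + h) * (2 ^ h * h ! * o)) ≡⟨ ring h (2 ^ h) (h !) o ⟩
  2 ^ suc h * suc h ! * (suc (h + h) * o)        ∎)
  where
  ring : ∀ h x y o → suc (suc (h + h)) * (suc (h + h) * (x * y * o)) ≡ 2 * x * (suc h * y) * (suc (h + h) * o)
  ring = solve-∀

halve : ∀ m → ∃[ h ] (m ≡ h + h ⊎ m ≡ suc (h + h))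
halve zero = 0 , inj₁ refl
halve (suc m) with halve m
... | h , inj₁ refl = h , inj₂ refl
... | h , inj₂ refl = suc h , inj₁ (cong suc (sym (+-suc h h)))

-- The valuation of `m !` is ⌊m/2⌋ plus that of ⌊m/2⌋!, and each of the `l` halvings loses at most 1
-- to rounding.
!-2adic : ∀ l m → m < 2 ^ l → ∃[ e ] ∃[ o ] 2 ∤ o × m ! ≡ 2 ^ e * o × e ≤ m × m ≤ e + l
!-2adic zero    zero    _ = 0 , 1 , 2∤1 , refl , z≤n , z≤n
!-2adic zero    (suc m) (s≤s ())
!-2adic (suc l) m m<2^ with halve m
... | h , inj₁ refl with o₁ , odd₁ , eq₁ ← double! h
                    with e , o , odd , eq , e≤h , h≤e+l ← !-2adic l h (*-cancelˡ-< 2 _ _ (subst (_< 2 ^ suc l) (cong (h +_) (sym (+-identityʳ h))) m<2^)) =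
  h + e , o * o₁ , odd-* o o₁ odd odd₁ , (begin-equality
    (h + h) !                 ≡⟨ eq₁ ⟩
    2 ^ h * h ! * o₁          ≡⟨ cong (λ z → 2 ^ h * z * o₁) eq ⟩
    2 ^ h * (2 ^ e * o) * o₁  ≡⟨ cong (_* o₁) (*-assoc (2 ^ h) _ _) ⟨
    2 ^ h * 2 ^ e * o * o₁    ≡⟨ *-assoc (2 ^ h * 2 ^ e) o o₁ ⟩
    2 ^ h * 2 ^ e * (o * o₁)  ≡⟨ cong (_* (o * o₁)) (^-distribˡ-+-* 2 h e) ⟨
    2 ^ (h + e) * (o * o₁)    ∎) , +-monoʳ-≤ h e≤h ,
  (begin
    h + h           ≤⟨ +-monoʳ-≤ h h≤e+l ⟩
    h + (e + l)     ≡⟨ +-assoc h e l ⟨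
    h + e + l       ≤⟨ +-monoʳ-≤ (h + e) (n≤1+n l) ⟩
    h + e + suc l   ∎)
... | h , inj₂ refl with o₁ , odd₁ , eq₁ ← double! h
                    with e , o , odd , eq , e≤h , h≤e+l ← !-2adic l h (*-cancelˡ-< 2 _ _ (<-trans (n<1+n _) (subst (λ z → suc z < 2 ^ suc l) (cong (h +_) (sym (+-identityʳ h))) m<2^))) =
  h + e , suc (h + h) * (o * o₁) , odd-* _ _ (2∤suc-double h) (odd-* o o₁ odd odd₁) , (begin-equality
    suc (h + h) * (h + h) !                     ≡⟨ cong (suc (h + h) *_) eq₁ ⟩
    suc (h + h) * (2 ^ h * h ! * o₁)            ≡⟨ cong (λ z → suc (h + h) * (2 ^ h * z * o₁)) eq ⟩
    suc (h + h) * (2 ^ h * (2 ^ e * o) * o₁)    ≡⟨ ring (suc (h + h)) (2 ^ h) (2 ^ e) o o₁ ⟩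
    2 ^ h * 2 ^ e * (suc (h + h) * (o * o₁))    ≡⟨ cong (_* (suc (h + h) * (o * o₁))) (^-distribˡ-+-* 2 h e) ⟨
    2 ^ (h + e) * (suc (h + h) * (o * o₁))      ∎) , ≤-trans (+-monoʳ-≤ h e≤h) (n≤1+n _) ,
  (begin
    suc (h + h)           ≤⟨ s≤s (+-monoʳ-≤ h h≤e+l) ⟩
    suc (h + (e + l))     ≡⟨ cong suc (+-assoc h e l) ⟨
    suc (h + e + l)       ≡⟨ +-suc (h + e) l ⟨
    h + e + suc l         ∎)
  where
  ring : ∀ s x y o p → s * (x * (y * o) * p) ≡ x * y * (s * (o * p))
  ring = solve-∀

∏!-2adic : ∀ l bs → All (_< 2 ^ l) bs → ∃[ e ] ∃[ o ] 2 ∤ o × ∏! bs ≡ 2 ^ e * o × e ≤ sum bs × sum bs ≤ e + length bs * l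
∏!-2adic l [] _ = 0 , 1 , 2∤1 , refl , z≤n , z≤n
∏!-2adic l (b ∷ bs) (b< ∷ bs<) with e , o , odd , eq , lo , hi ← !-2adic l b b<
                                 with e′ , o′ , odd′ , eq′ , lo′ , hi′ ← ∏!-2adic l bs bs< =
  e + e′ , o * o′ , odd-* o o′ odd odd′ , (begin-equality
    b ! * ∏! bs                   ≡⟨ cong₂ _*_ eq eq′ ⟩
    2 ^ e * o * (2 ^ e′ * o′)     ≡⟨ ring (2 ^ e) o (2 ^ e′) o′ ⟩
    2 ^ e * 2 ^ e′ * (o * o′)     ≡⟨ cong (_* (o * o′)) (^-distribˡ-+-* 2 e e′) ⟨
    2 ^ (e + e′) * (o * o′)       ∎) , +-mono-≤ lo lo′ , (begin
    b + sum bs                            ≤⟨ +-mono-≤ hi hi′ ⟩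
    e + l + (e′ + length bs * l)          ≡⟨ ring′ e l e′ (length bs * l) ⟩
    e + e′ + (l + length bs * l)          ∎)
  where
  ring : ∀ x o y p → x * o * (y * p) ≡ x * y * (o * p)
  ring = solve-∀
  ring′ : ∀ x o y p → x + o + (y + p) ≡ x + y + (o + p)
  ring′ = solve-∀

2adic-unique : ∀ e e′ o o′ → 2 ∤ o → 2 ∤ o′ → 2 ^ e * o ≡ 2 ^ e′ * o′ → e ≡ e′
2adic-unique zero    zero     o o′ _ _ _ = refl
2adic-unique zero    (suc e′) o o′ odd _ eq = contradiction
  (subst (2 ∣_) (trans (sym (*-assoc 2 (2 ^ e′) o′)) (trans (sym eq) (*-identityˡ o))) (m∣m*n (2 ^ e′ * o′))) odd
2adic-unique (suc e) zero     o o′ _ odd eq = contradiction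
  (subst (2 ∣_) (trans (sym (*-assoc 2 (2 ^ e) o)) (trans eq (*-identityˡ o′))) (m∣m*n (2 ^ e * o))) odd
2adic-unique (suc e) (suc e′) o o′ p q eq = cong suc (2adic-unique e e′ o o′ p q
  (*-cancelˡ-≡ _ _ 2 (trans (sym (*-assoc 2 (2 ^ e) o)) (trans eq (*-assoc 2 (2 ^ e′) o′)))))

-- v₂(m!) = m − (binary digit sum of m), so the 2-adic valuation of ∏! bs is the sum of bs up to a logarithm per entry.
sum-comparison : ∀ l bs cs → All (_< 2 ^ l) bs → All (_< 2 ^ l) cs → ∏! bs ≡ ∏! cs →
  sum bs ≤ sum cs + length bs * l
sum-comparison l bs cs bs< cs< eq
  with e , o , odd , p , _ , hi ← ∏!-2adic l bs bs<
  with e′ , o′ , odd′ , p′ , lo , _ ← ∏!-2adic l cs cs< = begin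
    sum bs                 ≤⟨ hi ⟩
    e + length bs * l      ≡⟨ cong (_+ length bs * l) (2adic-unique e e′ o o′ odd odd′ (trans (sym p) (trans eq p′))) ⟩
    e′ + length bs * l     ≤⟨ +-monoˡ-≤ (length bs * l) lo ⟩
    sum cs + length bs * l ∎

-- Power and logarithm estimates

n<2^n : ∀ n → n < 2 ^ n
n<2^n zero    = s≤s z≤n
n<2^n (suc n) = begin
  suc (suc n)           ≤⟨ +-mono-≤ (m^n>0 2 n) (n<2^n n) ⟩
  2 ^ n + 2 ^ n         ≡⟨ cong (2 ^ n +_) (+-identityʳ (2 ^ n)) ⟨
  2 ^ suc n             ∎

^-distribʳ-* : ∀ m n o → (m * n) ^ o ≡ m ^ o * n ^ o
^-distribʳ-* m n zero    = refl
^-distribʳ-* m n (suc o) = trans (cong (m * n *_) (^-distribʳ-* m n o)) (ring m n (m ^ o) (n ^ o))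
  where
  ring : ∀ x y z w → x * y * (z * w) ≡ x * z * (y * w)
  ring = solve-∀

^-comm : ∀ m n o → (m ^ n) ^ o ≡ (m ^ o) ^ n
^-comm m n o = trans (^-*-assoc m n o) (trans (cong (m ^_) (*-comm n o)) (sym (^-*-assoc m o n)))

^-cancelʳ-≤ : ∀ x y l .{{_ : NonZero l}} → x ^ l ≤ y ^ l → x ≤ y
^-cancelʳ-≤ x y l h = ≮⇒≥ λ y<x → <⇒≱ (^-monoˡ-< l y<x) h

2^-cancel-≤ : ∀ x y → 2 ^ x ≤ 2 ^ y → x ≤ y
2^-cancel-≤ x y h = ≮⇒≥ λ y<x → <⇒≱ (^-monoʳ-< 2 (s≤s (s≤s z≤n)) y<x) h

-- With d = e + 1 and q = ⌊x/d⌋ one has x ≤ d·2^q, so the e-th power of x falls short of 2^x by a factor 2^q.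
2^≤poly⇒≤ : ∀ D e x → 2 ^ x ≤ D * x ^ e → x ≤ suc e * (D * suc e ^ e)
2^≤poly⇒≤ D e x h = begin
  x                         ≤⟨ x≤ ⟩
  d * suc q                 ≤⟨ *-monoʳ-≤ d (≤-trans (n<2^n q) 2^q≤F) ⟩
  d * F                     ∎
  where
  d = suc e
  q = x / d
  F = D * d ^ e
  x≤ : x ≤ d * suc q
  x≤ = begin
    x                ≡⟨ m≡m%n+[m/n]*n x d ⟩
    x % d + q * d    ≤⟨ +-monoˡ-≤ (q * d) (<⇒≤ (m%n<n x d)) ⟩
    d + q * d        ≡⟨ *-comm (suc q) d ⟩
    d * suc q        ∎
  2^q≤F : 2 ^ q ≤ F
  2^q≤F = *-cancelʳ-≤ _ _ (2 ^ (q * e)) {{m^n≢0 2 (q * e)}} (begin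
    2 ^ q * 2 ^ (q * e)      ≡⟨ ^-distribˡ-+-* 2 q (q * e) ⟨
    2 ^ (q + q * e)          ≡⟨ cong (2 ^_) (*-suc q e) ⟨
    2 ^ (q * d)              ≤⟨ ^-monoʳ-≤ 2 (m/n*n≤m x d) ⟩
    2 ^ x                    ≤⟨ h ⟩
    D * x ^ e                ≤⟨ *-monoʳ-≤ D (^-monoˡ-≤ e (≤-trans x≤ (*-monoʳ-≤ d (n<2^n q)))) ⟩
    D * (d * 2 ^ q) ^ e      ≡⟨ cong (D *_) (^-distribʳ-* d (2 ^ q) e) ⟩
    D * (d ^ e * (2 ^ q) ^ e) ≡⟨ *-assoc D _ _ ⟨
    F * (2 ^ q) ^ e          ≡⟨ cong (F *_) (^-*-assoc 2 q e) ⟩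
    F * 2 ^ (q * e)          ∎)

-- Bernoulli's inequality (1 + h/a)^q ≥ 1 + qh/a, multiplied by a^(q+1) to avoid fractions.
bernoulli : ∀ a h q → a ^ q * (a + q * h) ≤ (a + h) ^ q * a
bernoulli a h zero    = ≤-reflexive (cong (1 *_) (+-identityʳ a))
bernoulli a h (suc q) = begin
  a * a ^ q * (a + (h + q * h))                   ≤⟨ m≤m+n _ (h * a ^ q * (q * h)) ⟩
  a * a ^ q * (a + (h + q * h)) + h * a ^ q * (q * h) ≡⟨ ring a (a ^ q) h (q * h) ⟩
  (a + h) * (a ^ q * (a + q * h))                 ≤⟨ *-monoʳ-≤ (a + h) (bernoulli a h q) ⟩
  (a + h) * ((a + h) ^ q * a)                     ≡⟨ *-assoc (a + h) _ a ⟨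
  (a + h) * (a + h) ^ q * a                       ∎
  where
  ring : ∀ a x h y → a * x * (a + (h + y)) + h * x * y ≡ (a + h) * (x * (a + y))
  ring = solve-∀

doubling : ∀ a h q .{{_ : NonZero a}} → a ≤ q * h → 2 * a ^ q ≤ (a + h) ^ q
doubling a h q a≤qh = *-cancelʳ-≤ _ _ a (begin
  2 * a ^ q * a        ≡⟨ ring (a ^ q) a ⟩
  a ^ q * (a + a)      ≤⟨ *-monoʳ-≤ (a ^ q) (+-monoʳ-≤ a a≤qh) ⟩
  a ^ q * (a + q * h)  ≤⟨ bernoulli a h q ⟩
  (a + h) ^ q * a      ∎)
  where
  ring : ∀ x a → 2 * x * a ≡ x * (a + a)
  ring = solve-∀

-- Cut the exponent `h` into `u` blocks of length `q = suc (a / h)`. Since a ≤ qh, `doubling` gains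
-- a factor 2 per block, so 2^u ≤ a^s and u ≤ ls. Then h ≤ (u+1)q together with qh ≤ a + h gives the
-- bound.
power-gap : ∀ a h s l .{{_ : NonZero a}} .{{_ : NonZero h}} → a ≤ 2 ^ l →
  (a + h) ^ h ≤ a ^ (h + s) → h * h ≤ suc (l * s) * (a + h)
power-gap a h s l a≤2^l gap = begin
  h * h                     ≤⟨ *-monoˡ-≤ h h≤ ⟩
  suc u * q * h             ≡⟨ *-assoc (suc u) q h ⟩
  suc u * (q * h)           ≤⟨ *-mono-≤ (s≤s u≤) qh≤ ⟩
  suc (l * s) * (a + h)     ∎
  where
  q = suc (a / h)
  u = h / q
  r = h % q
  h≡ : h ≡ r + q * u
  h≡ = trans (m≡m%n+[m/n]*n h q) (cong (r +_) (*-comm u q))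
  h≤ : h ≤ suc u * q
  h≤ = ≤-trans (≤-reflexive (m≡m%n+[m/n]*n h q)) (+-monoˡ-≤ (u * q) (<⇒≤ (m%n<n h q)))
  a≤qh : a ≤ q * h
  a≤qh = ≤-trans (≤-reflexive (m≡m%n+[m/n]*n a h)) (+-monoˡ-≤ (a / h * h) (<⇒≤ (m%n<n a h)))
  qh≤ : q * h ≤ a + h
  qh≤ = ≤-trans (+-monoʳ-≤ h (m/n*n≤m a h)) (≤-reflexive (+-comm h a))
  u≤ : u ≤ l * s
  u≤ = 2^-cancel-≤ u (l * s) (*-cancelʳ-≤ _ _ (a ^ h) {{m^n≢0 a h}} (begin
    2 ^ u * a ^ h                       ≡⟨ cong (λ z → 2 ^ u * a ^ z) h≡ ⟩
    2 ^ u * a ^ (r + q * u)             ≡⟨ cong (2 ^ u *_) (^-distribˡ-+-* a r (q * u)) ⟩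
    2 ^ u * (a ^ r * a ^ (q * u))       ≡⟨ cong (λ z → 2 ^ u * (a ^ r * z)) (^-*-assoc a q u) ⟨
    2 ^ u * (a ^ r * (a ^ q) ^ u)       ≡⟨ ring (2 ^ u) (a ^ r) ((a ^ q) ^ u) ⟩
    a ^ r * (2 ^ u * (a ^ q) ^ u)       ≡⟨ cong (a ^ r *_) (^-distribʳ-* 2 (a ^ q) u) ⟨
    a ^ r * (2 * a ^ q) ^ u             ≤⟨ *-mono-≤ (^-monoˡ-≤ r (m≤m+n a h)) (^-monoˡ-≤ u (doubling a h q a≤qh)) ⟩
    (a + h) ^ r * ((a + h) ^ q) ^ u     ≡⟨ cong ((a + h) ^ r *_) (^-*-assoc (a + h) q u) ⟩
    (a + h) ^ r * (a + h) ^ (q * u)     ≡⟨ ^-distribˡ-+-* (a + h) r (q * u) ⟨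
    (a + h) ^ (r + q * u)               ≡⟨ cong ((a + h) ^_) h≡ ⟨
    (a + h) ^ h                         ≤⟨ gap ⟩
    a ^ (h + s)                         ≡⟨ ^-distribˡ-+-* a h s ⟩
    a ^ h * a ^ s                       ≤⟨ *-monoʳ-≤ (a ^ h) (^-monoˡ-≤ s a≤2^l) ⟩
    a ^ h * (2 ^ l) ^ s                 ≡⟨ cong (a ^ h *_) (^-*-assoc 2 l s) ⟩
    a ^ h * 2 ^ (l * s)                 ≡⟨ *-comm (a ^ h) _ ⟩
    2 ^ (l * s) * a ^ h                 ∎))
    where
    ring : ∀ x y z → x * (y * z) ≡ y * (x * z)
    ring = solve-∀

-- Each of the `d` factors of `A !` above `B = 2 ^ (2 * w)` exceeds `B`, so 2wd ≤ wA. Hence at most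
-- half of `A` lies above `B`, and A ≤ 2B.
!≤2^⇒≤ : ∀ w A .{{_ : NonZero w}} → A ! ≤ 2 ^ (w * A) → A ≤ 2 * 2 ^ (2 * w)
!≤2^⇒≤ w A h with ≤-total A (2 ^ (2 * w))
... | inj₁ A≤B = ≤-trans A≤B (m≤m+n _ _)
... | inj₂ B≤A = +-cancelˡ-≤ A _ _ (begin
  A + A             ≡⟨ cong₂ _+_ B+d B+d ⟨
  B + d + (B + d)   ≡⟨ ring B d ⟩
  2 * d + 2 * B     ≤⟨ +-monoˡ-≤ (2 * B) 2d≤A ⟩
  A + 2 * B         ∎)
  where
  B = 2 ^ (2 * w)
  d = A ∸ B
  B+d : B + d ≡ A
  B+d = m+[n∸m]≡n B≤A
  ring : ∀ B d → B + d + (B + d) ≡ 2 * d + 2 * B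
  ring = solve-∀
  ring′ : ∀ w d → w * (2 * d) ≡ 2 * w * d
  ring′ = solve-∀
  2d≤A : 2 * d ≤ A
  2d≤A = *-cancelˡ-≤ w (2^-cancel-≤ _ _ (begin
    2 ^ (w * (2 * d))  ≡⟨ cong (2 ^_) (ring′ w d) ⟩
    2 ^ (2 * w * d)    ≡⟨ ^-*-assoc 2 (2 * w) d ⟨
    B ^ d              ≤⟨ ^≤rising B d ⟩
    rising B d         ≤⟨ m≤n*m (rising B d) (B !) {{B !≢0}} ⟩
    B ! * rising B d   ≡⟨ !*rising B d ⟩
    (B + d) !          ≡⟨ cong _! B+d ⟩
    A !                ≤⟨ h ⟩
    2 ^ (w * A)        ∎))

-- Bounding log n

-- P ≤ A^(k+s) against a^k < P excludes A³ ≤ a²; the complementary a² < A³ makes k at least of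
-- order n^(2/3), while A ≤ a and the excess of P over a^k keep k² within n times a power of log n.
long-gap⇒≤poly : ∀ γ n a k h s A L .{{_ : NonZero A}} .{{_ : NonZero h}} →
  a + k ≡ n → 2 * h ≤ k → k ≤ 3 * h → 1 ≤ γ → n < 2 ^ L →
  rising a k ≤ A ^ (k + s) → A ≤ a → A ≤ γ * k → 2 * s ≤ k →
  n ≤ 16 * (γ * γ * γ) * (γ * γ * γ) *
    (9 * suc (L * s) * (9 * suc (L * s)) * (9 * suc (L * s)))
long-gap⇒≤poly γ n a k h s A L refl 2h≤k k≤3h 1≤γ n<2^L P≤ A≤a A≤γk 2s≤k =
  -- Squaring n² ≤ 4(γk)³ and cubing k² ≤ En gives n⁴ ≤ Gk⁶ ≤ GE³n³, from which n³ cancels.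
  *-cancelʳ-≤ _ _ (n * n * n) {{m*n≢0 (n * n) n {{m*n≢0 n n}}}} (begin
    n * (n * n * n)                     ≡⟨ r₁ n ⟩
    n * n * (n * n)                     ≤⟨ *-mono-≤ nn≤ nn≤ ⟩
    4 * (γ * k * (γ * k) * (γ * k)) * (4 * (γ * k * (γ * k) * (γ * k))) ≡⟨ r₂ γ k ⟩
    G * (k * k * (k * k) * (k * k))     ≤⟨ *-monoʳ-≤ G (*-mono-≤ (*-mono-≤ kk≤ kk≤) kk≤) ⟩
    G * (E * n * (E * n) * (E * n))     ≡⟨ r₃ G E n ⟩
    G * (E * E * E) * (n * n * n)       ∎)
  where
  E = 9 * suc (L * s)
  G = 16 * (γ * γ * γ) * (γ * γ * γ)
  instance
    a≢0 : NonZero a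
    a≢0 = >-nonZero (≤-trans (>-nonZero⁻¹ A) A≤a)
    n≢0 : NonZero n
    n≢0 = >-nonZero (≤-trans (>-nonZero⁻¹ a) (m≤m+n a k))
    k≢0 : NonZero k
    k≢0 = >-nonZero (≤-trans (>-nonZero⁻¹ h) (≤-trans (m≤m+n h _) 2h≤k))
  r₁ : ∀ n → n * (n * n * n) ≡ n * n * (n * n)
  r₁ = solve-∀
  r₂ : ∀ γ k → 4 * (γ * k * (γ * k) * (γ * k)) * (4 * (γ * k * (γ * k) * (γ * k)))
     ≡ 16 * (γ * γ * γ) * (γ * γ * γ) * (k * k * (k * k) * (k * k))
  r₂ = solve-∀
  r₃ : ∀ G E n → G * (E * n * (E * n) * (E * n)) ≡ G * (E * E * E) * (n * n * n)
  r₃ = solve-∀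
  k≤γk : k ≤ γ * k
  k≤γk = m≤n*m k γ {{>-nonZero 1≤γ}}
  -- The condition 2s ≤ k makes 2(k+s) ≤ 3k, so the squared upper bound on the rising product is at
  -- most (A³)^k, while its square strictly exceeds (a²)^k.
  aa< : a * a < γ * k * (γ * k) * (γ * k)
  aa< = ≰⇒> λ A³≤a² → <-irrefl refl (begin-strict
    (A * A * A) ^ k                 ≤⟨ ^-monoˡ-≤ k (≤-trans (*-mono-≤ (*-mono-≤ A≤γk A≤γk) A≤γk) A³≤a²) ⟩
    (a * a) ^ k                     ≡⟨ ^-distribʳ-* a a k ⟩
    a ^ k * a ^ k                   <⟨ *-mono-< a^k<P a^k<P ⟩
    rising a k * rising a k         ≤⟨ *-mono-≤ P≤ P≤ ⟩
    A ^ (k + s) * A ^ (k + s)       ≡⟨ ^-distribˡ-+-* A (k + s) (k + s) ⟨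
    A ^ (k + s + (k + s))           ≤⟨ ^-monoʳ-≤ A e≤ ⟩
    A ^ (3 * k)                     ≡⟨ ^-*-assoc A 3 k ⟨
    (A ^ 3) ^ k                     ≡⟨ cong (_^ k) (r₄ A) ⟩
    (A * A * A) ^ k                 ∎)
    where
    a^k<P : a ^ k < rising a k
    a^k<P = <-≤-trans (^-monoˡ-< k (n<1+n a)) (suc-^≤rising a k)
    r₄ : ∀ A → A * (A * (A * 1)) ≡ A * A * A
    r₄ = solve-∀
    r₅ : ∀ k s → k + s + (k + s) ≡ 2 * s + 2 * k
    r₅ = solve-∀
    e≤ : k + s + (k + s) ≤ 3 * k
    e≤ = ≤-trans (≤-reflexive (r₅ k s)) (+-monoˡ-≤ (2 * k) 2s≤k)
  nn≤ : n * n ≤ 4 * (γ * k * (γ * k) * (γ * k))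
  nn≤ with ≤-total a k
  ... | inj₁ a≤k = begin
    n * n                 ≤⟨ *-mono-≤ (+-monoˡ-≤ k a≤k) (+-monoˡ-≤ k a≤k) ⟩
    (k + k) * (k + k)     ≡⟨ r k ⟩
    4 * (k * k)           ≤⟨ *-monoʳ-≤ 4 (*-mono-≤ k≤γk k≤γk) ⟩
    4 * (γ * k * (γ * k)) ≤⟨ *-monoʳ-≤ 4 (m≤m*n (γ * k * (γ * k)) (γ * k) {{>-nonZero (≤-trans (>-nonZero⁻¹ k) k≤γk)}}) ⟩
    4 * (γ * k * (γ * k) * (γ * k)) ∎
    where
    r : ∀ k → (k + k) * (k + k) ≡ 4 * (k * k)
    r = solve-∀
  ... | inj₂ k≤a = begin
    n * n                 ≤⟨ *-mono-≤ (+-monoʳ-≤ a k≤a) (+-monoʳ-≤ a k≤a) ⟩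
    (a + a) * (a + a)     ≡⟨ r a ⟩
    4 * (a * a)           ≤⟨ *-monoʳ-≤ 4 (<⇒≤ aa<) ⟩
    4 * (γ * k * (γ * k) * (γ * k)) ∎
    where
    r : ∀ k → (k + k) * (k + k) ≡ 4 * (k * k)
    r = solve-∀
  -- Only the last `h` factors are bounded below by a + h, which is valid because x = k - h ≥ h; the
  -- first `x` are bounded by `a`, and a^x cancels.
  gap : (a + h) ^ h ≤ a ^ (h + s)
  gap = *-cancelˡ-≤ (a ^ x) {{m^n≢0 a x}} (begin
    a ^ x * (a + h) ^ h          ≤⟨ *-mono-≤ (^≤rising a x) (≤-trans (^-monoˡ-≤ h (+-monoʳ-≤ a h≤x)) (^≤rising (a + x) h)) ⟩
    rising a x * rising (a + x) h ≡⟨ rising-+ a x h ⟨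
    rising a (x + h)             ≡⟨ cong (rising a) x+h ⟩
    rising a k                   ≤⟨ P≤ ⟩
    A ^ (k + s)                  ≤⟨ ^-monoˡ-≤ (k + s) A≤a ⟩
    a ^ (k + s)                  ≡⟨ cong (λ z → a ^ (z + s)) x+h ⟨
    a ^ (x + h + s)              ≡⟨ cong (a ^_) (+-assoc x h s) ⟩
    a ^ (x + (h + s))            ≡⟨ ^-distribˡ-+-* a x (h + s) ⟩
    a ^ x * a ^ (h + s)          ∎)
    where
    x = k ∸ h
    h≤k : h ≤ k
    h≤k = ≤-trans (m≤m+n h _) 2h≤k
    x+h : x + h ≡ k
    x+h = m∸n+n≡m h≤k
    h≤x : h ≤ x
    h≤x = +-cancelʳ-≤ h h x (≤-trans (≤-reflexive (cong (h +_) (sym (+-identityʳ h)))) (≤-trans 2h≤k (≤-reflexive (sym x+h))))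
  kk≤ : k * k ≤ E * n
  kk≤ = begin
    k * k                         ≤⟨ *-mono-≤ k≤3h k≤3h ⟩
    3 * h * (3 * h)               ≡⟨ r h ⟩
    9 * (h * h)                   ≤⟨ *-monoʳ-≤ 9 (power-gap a h s L (≤-trans (m≤m+n a k) (<⇒≤ n<2^L)) gap) ⟩
    9 * (suc (L * s) * (a + h))   ≤⟨ *-monoʳ-≤ 9 (*-monoʳ-≤ (suc (L * s)) (+-monoʳ-≤ a (≤-trans (m≤m+n h _) 2h≤k))) ⟩
    9 * (suc (L * s) * n)         ≡⟨ *-assoc 9 (suc (L * s)) n ⟨
    E * n                         ∎
    where
    r : ∀ h → 3 * h * (3 * h) ≡ 9 * (h * h)
    r = solve-∀

-- Raised to the power `L`, the left side becomes (2^L)^k ≤ a^(2k) ≤ A^(2(k+tL)), and k ≤ 2tL makes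
-- this exponent at most 6tL; then the `L`-th root is taken. With A = O(L) this puts `k` at order
-- log L.
short-gap⇒2^k≤ : ∀ t g a k A L .{{_ : NonZero A}} .{{_ : NonZero L}} → 2 ^ L ≤ a * a → k ≤ 2 * (t * L) →
  rising a k ≤ A ^ (k + t * L) → A ≤ g * L → 2 ^ k ≤ (g * L) ^ (6 * t)
short-gap⇒2^k≤ t g a k A L 2^L≤aa k≤ P≤ A≤ = ^-cancelʳ-≤ _ _ L (begin
  (2 ^ k) ^ L                  ≡⟨ ^-comm 2 k L ⟩
  (2 ^ L) ^ k                  ≤⟨ ^-monoˡ-≤ k 2^L≤aa ⟩
  (a * a) ^ k                  ≡⟨ ^-distribʳ-* a a k ⟩
  a ^ k * a ^ k                ≤⟨ *-mono-≤ (≤-trans (^≤rising a k) P≤) (≤-trans (^≤rising a k) P≤) ⟩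
  A ^ (k + s) * A ^ (k + s)    ≡⟨ ^-distribˡ-+-* A (k + s) (k + s) ⟨
  A ^ (k + s + (k + s))        ≤⟨ ^-monoʳ-≤ A e≤ ⟩
  A ^ (6 * t * L)              ≤⟨ ^-monoˡ-≤ (6 * t * L) A≤ ⟩
  (g * L) ^ (6 * t * L)        ≡⟨ ^-*-assoc (g * L) (6 * t) L ⟨
  ((g * L) ^ (6 * t)) ^ L      ∎)
  where
  s = t * L
  r : ∀ t L → 2 * (t * L) + t * L + (2 * (t * L) + t * L) ≡ 6 * t * L
  r = solve-∀
  e≤ : k + s + (k + s) ≤ 6 * t * L
  e≤ = ≤-trans (+-mono-≤ (+-monoˡ-≤ s k≤) (+-monoˡ-≤ s k≤)) (≤-reflexive (r t L))

-- Comparing exponents of 2 gives 2Lh ≤ 7(3A + k³). Tripling and k ≤ 3h turn this into 2kL ≤ 63A +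
-- 21k³, and 21k² ≤ L lets one copy of kL absorb the cubic term.
abc⇒k*L≤63*A : ∀ a k h A L → 2 ^ L ≤ a * a → k ≤ 3 * h → 21 * (k * k) ≤ L →
  (a ^ 4) ^ h ≤ (8 ^ A * k ^ (k * k)) ^ 7 → k * L ≤ 63 * A
abc⇒k*L≤63*A a k h A L 2^L≤aa k≤3h 21kk≤L H = +-cancelʳ-≤ (k * L) _ _ (begin
  k * L + k * L                        ≤⟨ +-mono-≤ (*-monoˡ-≤ L k≤3h) (*-monoˡ-≤ L k≤3h) ⟩
  3 * h * L + 3 * h * L                ≡⟨ r₁ h L ⟩
  3 * (L * 2 * h)                      ≤⟨ *-monoʳ-≤ 3 (2^-cancel-≤ (L * 2 * h) ((3 * A + k * (k * k)) * 7) exps) ⟩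
  3 * ((3 * A + k * (k * k)) * 7)      ≡⟨ r₂ A k ⟩
  63 * A + k * (21 * (k * k))          ≤⟨ +-monoʳ-≤ (63 * A) (*-monoʳ-≤ k 21kk≤L) ⟩
  63 * A + k * L                       ∎)
  where
  r₁ : ∀ h L → 3 * h * L + 3 * h * L ≡ 3 * (L * 2 * h)
  r₁ = solve-∀
  r₂ : ∀ A k → 3 * ((3 * A + k * (k * k)) * 7) ≡ 63 * A + k * (21 * (k * k))
  r₂ = solve-∀
  r₃ : ∀ a → a * a * (a * a * 1) ≡ a * (a * (a * (a * 1)))
  r₃ = solve-∀
  exps : 2 ^ (L * 2 * h) ≤ 2 ^ ((3 * A + k * (k * k)) * 7)
  exps = begin
    2 ^ (L * 2 * h)                         ≡⟨ ^-*-assoc 2 (L * 2) h ⟨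
    (2 ^ (L * 2)) ^ h                       ≡⟨ cong (_^ h) (^-*-assoc 2 L 2) ⟨
    ((2 ^ L) ^ 2) ^ h                       ≤⟨ ^-monoˡ-≤ h (^-monoˡ-≤ 2 2^L≤aa) ⟩
    ((a * a) ^ 2) ^ h                       ≡⟨ cong (_^ h) (r₃ a) ⟩
    (a ^ 4) ^ h                             ≤⟨ H ⟩
    (8 ^ A * k ^ (k * k)) ^ 7               ≤⟨ ^-monoˡ-≤ 7 (*-monoʳ-≤ (8 ^ A) (^-monoˡ-≤ (k * k) (<⇒≤ (n<2^n k)))) ⟩
    (8 ^ A * (2 ^ k) ^ (k * k)) ^ 7         ≡⟨ cong₂ (λ x y → (x * y) ^ 7) (^-*-assoc 2 3 A) (^-*-assoc 2 k (k * k)) ⟩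
    (2 ^ (3 * A) * 2 ^ (k * (k * k))) ^ 7   ≡⟨ cong (_^ 7) (^-distribˡ-+-* 2 (3 * A) (k * (k * k))) ⟨
    (2 ^ (3 * A + k * (k * k))) ^ 7         ≡⟨ ^-*-assoc 2 (3 * A + k * (k * k)) 7 ⟩
    2 ^ ((3 * A + k * (k * k)) * 7)         ∎

-- With s = tL, the factor 1 + Ls is at most (t+1)L², so its cube has degree 6 in `L`. This is the
-- shape that `2^≤poly⇒≤` turns into a bound on `L`.
long-gap⇒2^L≤ : ∀ t γ n a k h A L .{{_ : NonZero A}} .{{_ : NonZero h}} .{{_ : NonZero L}} →
  a + k ≡ n → 2 * h ≤ k → k ≤ 3 * h → 1 ≤ γ → n < 2 ^ L → 2 ^ L ≤ 2 * n →
  rising a k ≤ A ^ (k + t * L) → A ≤ a → A ≤ γ * k → 2 * (t * L) ≤ k →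
  2 ^ L ≤ 2 * (16 * (γ * γ * γ) * (γ * γ * γ) * (9 * suc t * (9 * suc t) * (9 * suc t))) * L ^ 6
long-gap⇒2^L≤ t γ n a k h A L eq 2h≤k k≤3h 1≤γ n<2^L 2^L≤2n P≤ A≤a A≤γk 2s≤k = begin
  2 ^ L                 ≤⟨ 2^L≤2n ⟩
  2 * n                 ≤⟨ *-monoʳ-≤ 2 (long-gap⇒≤poly γ n a k h (t * L) A L eq 2h≤k k≤3h 1≤γ n<2^L P≤ A≤a A≤γk 2s≤k) ⟩
  2 * (G * (E * E * E)) ≤⟨ *-monoʳ-≤ 2 (*-monoʳ-≤ G (*-mono-≤ (*-mono-≤ E≤ E≤) E≤)) ⟩
  2 * (G * (E′ * (L * L) * (E′ * (L * L)) * (E′ * (L * L)))) ≡⟨ r G E′ L ⟩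
  2 * (G * (E′ * E′ * E′)) * L ^ 6 ∎
  where
  G = 16 * (γ * γ * γ) * (γ * γ * γ)
  E = 9 * suc (L * (t * L))
  E′ = 9 * suc t
  r : ∀ G E L → 2 * (G * (E * (L * L) * (E * (L * L)) * (E * (L * L)))) ≡ 2 * (G * (E * E * E)) * (L * (L * (L * (L * (L * (L * 1))))))
  r = solve-∀
  r′ : ∀ t L → L * L + L * (t * L) ≡ suc t * (L * L)
  r′ = solve-∀
  E≤ : E ≤ E′ * (L * L)
  E≤ = begin
    9 * suc (L * (t * L))          ≤⟨ *-monoʳ-≤ 9 (+-monoˡ-≤ (L * (t * L)) (>-nonZero⁻¹ (L * L) {{m*n≢0 L L}})) ⟩
    9 * (L * L + L * (t * L))      ≡⟨ cong (9 *_) (r′ t L) ⟩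
    9 * (suc t * (L * L))          ≡⟨ *-assoc 9 (suc t) (L * L) ⟨
    E′ * (L * L)                   ∎

-- Here `L` stands for log₂ n, `h` for about half of `k`, and `A` for the largest remaining entry.
-- The last inequality is what abc supplies, so establishing a `LogBound` is pure arithmetic.
LogBound : (t c L₀ : ℕ) → Set
LogBound t c L₀ = ∀ n a k h A L → NonZero A → 1 ≤ h → a + k ≡ n → 2 * h ≤ k → k ≤ 3 * h →
  n < 2 ^ L → 2 ^ L ≤ 2 * n →
  rising a k ≤ A ^ (k + t * L) → A ≤ a → A ≤ suc c * k + t * L → A ! ≤ n ^ (suc c * k) →
  (a ^ 4) ^ h ≤ (8 ^ A * k ^ (k * k)) ^ 7 → L ≤ L₀

-- The constants stay variables (and log-bound is abstract): their unary values are too large to normalise.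
log-bound-from : ∀ t c D g w L₁ L₂ K B →
  D ≡ 2 * (16 * (suc (suc c) * suc (suc c) * suc (suc c)) * (suc (suc c) * suc (suc c) * suc (suc c)) * (9 * suc t * (9 * suc t) * (9 * suc t))) →
  g ≡ (2 * suc c + 1) * t → w ≡ 63 * suc c →
  (∀ x → 2 ^ x ≤ D * x ^ 6 → x ≤ L₁) → (∀ x → 2 ^ x ≤ 8 * t * x ^ 1 → x ≤ L₂) →
  (∀ x → 2 ^ x ≤ (g * 21) ^ (6 * t) * x ^ (2 * (6 * t)) → x ≤ K) → (∀ x → x ! ≤ 2 ^ (w * x) → x ≤ B) →
  LogBound t c (L₁ + L₂ + 16 + 21 * (K * K) + 63 * B)
log-bound-from t c D g w L₁ L₂ K B D≡ g≡ w≡ b₁ b₂ b₃ b₄ = bound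
  where
  -- One summand for each of the five cases distinguished in `bound`.
  total = L₁ + L₂ + 16 + 21 * (K * K) + 63 * B
  ∈₁ : L₁ ≤ total
  ∈₁ = ≤-trans (m≤m+n L₁ L₂) (≤-trans (m≤m+n (L₁ + L₂) 16) (≤-trans (m≤m+n _ (21 * (K * K))) (m≤m+n _ (63 * B))))
  ∈₂ : L₂ ≤ total
  ∈₂ = ≤-trans (m≤n+m L₂ L₁) (≤-trans (m≤m+n (L₁ + L₂) 16) (≤-trans (m≤m+n _ (21 * (K * K))) (m≤m+n _ (63 * B))))
  ∈₃ : 16 ≤ total
  ∈₃ = ≤-trans (m≤n+m 16 (L₁ + L₂)) (≤-trans (m≤m+n (L₁ + L₂ + 16) (21 * (K * K))) (m≤m+n _ (63 * B)))
  ∈₄ : 21 * (K * K) ≤ total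
  ∈₄ = ≤-trans (m≤n+m (21 * (K * K)) (L₁ + L₂ + 16)) (m≤m+n _ (63 * B))
  ∈₅ : 63 * B ≤ total
  ∈₅ = m≤n+m (63 * B) (L₁ + L₂ + 16 + 21 * (K * K))

  bound : LogBound t c total
  bound n a k h A zero _ _ _ _ _ _ _ _ _ _ _ _ = z≤n
  bound n a k h A L@(suc _) A≢0 1≤h n≡ 2h≤k k≤3h n<2^L 2^L≤2n P≤ A≤a A≤ A!≤ H
    with ≤-total (2 * (t * L)) k
  ... | inj₁ 2s≤k = ≤-trans (b₁ L (≤-trans (long-gap⇒2^L≤ t (suc (suc c)) n a k h A L {{A≢0}} {{>-nonZero 1≤h}} n≡ 2h≤k k≤3h (s≤s z≤n) n<2^L 2^L≤2n P≤ A≤a A≤γk 2s≤k) (≤-reflexive (cong (_* L ^ 6) (sym D≡))))) ∈₁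
    where
    A≤γk : A ≤ suc (suc c) * k
    A≤γk = begin
      A                    ≤⟨ A≤ ⟩
      suc c * k + t * L    ≤⟨ +-monoʳ-≤ (suc c * k) (≤-trans (m≤m+n (t * L) _) 2s≤k) ⟩
      suc c * k + k        ≡⟨ +-comm (suc c * k) k ⟩
      suc (suc c) * k      ∎
  -- The threshold is chosen so that 4k ≤ 8tL ≤ 2^L can be absorbed, leaving 2^L ≤ 4a; the power
  -- `L ^ 1` matches the form of `b₂`.
  ... | inj₂ k≤2s with ≤-total (2 ^ L) (8 * t * L ^ 1)
  ... | inj₁ 2^L≤8s = ≤-trans (b₂ L 2^L≤8s) ∈₂
  ... | inj₂ 8s≤2^L = cases
    where
    2^L≤4a : 2 ^ L ≤ 4 * a
    2^L≤4a = +-cancelʳ-≤ (2 ^ L) _ _ (begin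
      2 ^ L + 2 ^ L                ≤⟨ +-mono-≤ 2^L≤2n 2^L≤2n ⟩
      2 * n + 2 * n                ≡⟨ cong (λ z → 2 * z + 2 * z) n≡ ⟨
      2 * (a + k) + 2 * (a + k)    ≡⟨ r₁ a k ⟩
      4 * a + 4 * k                ≤⟨ +-monoʳ-≤ (4 * a) (*-monoʳ-≤ 4 k≤2s) ⟩
      4 * a + 4 * (2 * (t * L))    ≡⟨ cong (4 * a +_) (r₂ t L) ⟩
      4 * a + 8 * t * L ^ 1        ≤⟨ +-monoʳ-≤ (4 * a) 8s≤2^L ⟩
      4 * a + 2 ^ L                ∎)
      where
      r₁ : ∀ a k → 2 * (a + k) + 2 * (a + k) ≡ 4 * a + 4 * k
      r₁ = solve-∀
      r₂ : ∀ t L → 4 * (2 * (t * L)) ≡ 8 * t * (L * 1)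
      r₂ = solve-∀
    A≤gL : A ≤ g * L
    A≤gL = begin
      A                                 ≤⟨ A≤ ⟩
      suc c * k + t * L                 ≤⟨ +-monoˡ-≤ (t * L) (*-monoʳ-≤ (suc c) k≤2s) ⟩
      suc c * (2 * (t * L)) + t * L     ≡⟨ r (suc c) t L ⟩
      (2 * suc c + 1) * t * L           ≡⟨ cong (_* L) g≡ ⟨
      g * L                             ∎
      where
      r : ∀ c t L → c * (2 * (t * L)) + t * L ≡ (2 * c + 1) * t * L
      r = solve-∀
    cases : L ≤ total
    -- For a ≥ 4 the bound 2^L ≤ 4a becomes 2^L ≤ a²; otherwise L < 2^L ≤ 16.
    cases with ≤-total a 4
    ... | inj₁ a≤4 = ≤-trans (≤-trans (<⇒≤ (n<2^n L)) (≤-trans 2^L≤4a (*-monoʳ-≤ 4 a≤4))) ∈₃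
    ... | inj₂ 4≤a with ≤-total L (21 * (k * k))
    -- Substituting L ≤ 21k² into `short-gap⇒2^k≤` bounds 2^k by a polynomial in `k` alone, so `k`
    -- is bounded and then `L`.
    ... | inj₁ L≤ = ≤-trans (≤-trans L≤ (*-monoʳ-≤ 21 (*-mono-≤ k≤K k≤K))) ∈₄
      where
      k≤K : k ≤ K
      k≤K = b₃ k (begin
        2 ^ k                                   ≤⟨ short-gap⇒2^k≤ t g a k A L {{A≢0}} (≤-trans 2^L≤4a (*-monoˡ-≤ a 4≤a)) k≤2s P≤ A≤gL ⟩
        (g * L) ^ (6 * t)                       ≤⟨ ^-monoˡ-≤ (6 * t) (*-monoʳ-≤ g L≤) ⟩
        (g * (21 * (k * k))) ^ (6 * t)          ≡⟨ cong (_^ (6 * t)) (r g k) ⟩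
        (g * 21 * k ^ 2) ^ (6 * t)              ≡⟨ ^-distribʳ-* (g * 21) (k ^ 2) (6 * t) ⟩
        (g * 21) ^ (6 * t) * (k ^ 2) ^ (6 * t)  ≡⟨ cong ((g * 21) ^ (6 * t) *_) (^-*-assoc k 2 (6 * t)) ⟩
        (g * 21) ^ (6 * t) * k ^ (2 * (6 * t))  ∎)
        where
        r : ∀ g k → g * (21 * (k * k)) ≡ g * 21 * (k * (k * 1))
        r = solve-∀
    -- Now abc gives kL ≤ 63A. Fed into the bound on `A !`, this yields A! ≤ 2^(wA), which bounds
    -- `A` and in turn `L`.
    ... | inj₂ ≤L = ≤-trans (≤-trans (m≤n*m L k {{>-nonZero 1≤k}}) (≤-trans kL≤ (*-monoʳ-≤ 63 A≤B))) ∈₅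
      where
      1≤k : 1 ≤ k
      1≤k = ≤-trans 1≤h (≤-trans (m≤m+n h _) 2h≤k)
      kL≤ : k * L ≤ 63 * A
      kL≤ = abc⇒k*L≤63*A a k h A L (≤-trans 2^L≤4a (*-monoˡ-≤ a 4≤a)) k≤3h ≤L H
      A≤B : A ≤ B
      A≤B = b₄ A (begin
        A !                          ≤⟨ A!≤ ⟩
        n ^ (suc c * k)              ≤⟨ ^-monoˡ-≤ (suc c * k) (<⇒≤ n<2^L) ⟩
        (2 ^ L) ^ (suc c * k)        ≡⟨ ^-*-assoc 2 L (suc c * k) ⟩
        2 ^ (L * (suc c * k))        ≡⟨ cong (2 ^_) (r₁ L (suc c) k) ⟩
        2 ^ (suc c * (k * L))        ≤⟨ ^-monoʳ-≤ 2 (*-monoʳ-≤ (suc c) kL≤) ⟩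
        2 ^ (suc c * (63 * A))       ≡⟨ cong (2 ^_) (r₂ (suc c) A) ⟩
        2 ^ (63 * suc c * A)         ≡⟨ cong (λ z → 2 ^ (z * A)) w≡ ⟨
        2 ^ (w * A)                  ∎)
        where
        r₁ : ∀ L c k → L * (c * k) ≡ c * (k * L)
        r₁ = solve-∀
        r₂ : ∀ c A → c * (63 * A) ≡ 63 * c * A
        r₂ = solve-∀

abstract
  log-bound : ∀ t c → ∃[ L₀ ] LogBound t c L₀
  log-bound t c = bounds _ _ _ refl refl refl
    where
    bounds : ∀ D g w →
      D ≡ 2 * (16 * (suc (suc c) * suc (suc c) * suc (suc c)) * (suc (suc c) * suc (suc c) * suc (suc c)) * (9 * suc t * (9 * suc t) * (9 * suc t))) →
      g ≡ (2 * suc c + 1) * t → w ≡ 63 * suc c → ∃[ L₀ ] LogBound t c L₀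
    bounds D g w D≡ g≡ w≡ = _ , log-bound-from t c D g w _ _ _ _ D≡ g≡ w≡
      (2^≤poly⇒≤ D 6) (2^≤poly⇒≤ (8 * t) 1) (2^≤poly⇒≤ ((g * 21) ^ (6 * t)) (2 * (6 * t)))
      (λ x → !≤2^⇒≤ w x {{subst NonZero (sym w≡) _}})

-- Radicals and the abc conjecture

prime∣!⇒≤ : ∀ {p} → Prime p → ∀ m → p ∣ m ! → p ≤ m
prime∣!⇒≤ pr zero    p∣1 = contradiction (subst Prime (∣1⇒≡1 p∣1) pr) ¬prime[1]
prime∣!⇒≤ pr (suc m) p∣  with euclidsLemma (suc m) (m !) pr p∣
... | inj₁ p∣m  = ∣⇒≤ p∣m
... | inj₂ p∣m! = m≤n⇒m≤1+n (prime∣!⇒≤ pr m p∣m!)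

prime∣prime⇒≡ : ∀ {p q} → Prime p → Prime q → p ∣ q → p ≡ q
prime∣prime⇒≡ pr qr p∣q with prime⇒irreducible qr p∣q
... | inj₁ refl = contradiction pr ¬prime[1]
... | inj₂ p≡q  = p≡q

-- Dividing out the first prime leaves the others as divisors of the quotient, since a prime divides
-- no other prime.
distinctPrimes⇒product∣ : ∀ ps N → Unique ps → All (λ p → Prime p × p ∣ N) ps → product ps ∣ N
distinctPrimes⇒product∣ []       N _ _ = 1∣ N
distinctPrimes⇒product∣ (p ∷ ps) N (p≢ ∷ uniq) ((pr , divides N′ refl) ∷ all) =
  subst (p * product ps ∣_) (*-comm p N′) (*-monoʳ-∣ p (distinctPrimes⇒product∣ ps N′ uniq (All.zipWith split (p≢ , all))))
  where
  split : ∀ {q} → (p ≢ q) × (Prime q × q ∣ N′ * p) → Prime q × q ∣ N′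
  split (p≢q , qr , q∣) with euclidsLemma N′ p qr q∣
  ... | inj₁ q∣N′ = qr , q∣N′
  ... | inj₂ q∣p  = contradiction (sym (prime∣prime⇒≡ qr pr q∣p)) p≢q

rad∣ : ∀ n N → (∀ p → Prime p → p ∣ n → p ∣ N) → rad n ∣ N
rad∣ n N h = distinctPrimes⇒product∣ _ N (Unique.filter⁺ P? (Unique.upTo⁺ (suc n)))
  (All.tabulate λ x∈ → let (pr , p∣n) = proj₂ (∈-filter⁻ P? {xs = upTo (suc n)} x∈) in pr , h _ pr p∣n)
  where P? = λ p → prime? p ×-dec p ∣? n

-- Product of the primes up to n

C≤2^ : ∀ n k → n C k ≤ 2 ^ n
C≤2^ n       zero    = m^n>0 2 n
C≤2^ zero    (suc k) = z≤n
C≤2^ (suc n) (suc k) = begin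
  suc n C suc k          ≡⟨ nCk+nC[k+1]≡[n+1]C[k+1] n k ⟨
  n C k + n C suc k      ≤⟨ +-mono-≤ (C≤2^ n k) (C≤2^ n (suc k)) ⟩
  2 ^ n + 2 ^ n          ≡⟨ cong (2 ^ n +_) (+-identityʳ (2 ^ n)) ⟨
  2 ^ suc n              ∎

!≡C*!*! : ∀ x y → (x + y) ! ≡ ((x + y) C x) * (x ! * y !)
!≡C*!*! x y = begin-equality
  (x + y) !                                       ≡⟨ m/n*n≡m (k![n∸k]!∣n! (m≤m+n x y)) ⟨
  (x + y) ! / (x ! * (x + y ∸ x) !) * (x ! * (x + y ∸ x) !) ≡⟨ cong (_* (x ! * (x + y ∸ x) !)) (nCk≡n!/k![n-k]! (m≤m+n x y)) ⟨
  ((x + y) C x) * (x ! * (x + y ∸ x) !)           ≡⟨ cong (λ z → ((x + y) C x) * (x ! * z !)) (m+n∸m≡n x y) ⟩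
  ((x + y) C x) * (x ! * y !)                     ∎
  where instance _ = x !* (x + y ∸ x) !≢0

-- A prime p with ⌈n/2⌉ < p ≤ n divides the central binomial coefficient.
multipleOfPrimes≤ : ∀ n → ∃[ Q ] 1 ≤ Q × Q ≤ 8 ^ n × (∀ p → Prime p → p ≤ n → p ∣ Q)
multipleOfPrimes≤ = <-rec _ step
  where
  Goal : ℕ → Set
  Goal n = ∃[ Q ] 1 ≤ Q × Q ≤ 8 ^ n × (∀ p → Prime p → p ≤ n → p ∣ Q)
  step : ∀ n → (∀ {m} → m < n → Goal m) → Goal n
  step zero rec = 1 , ≤-refl , ≤-refl , λ p pr p≤0 → contradiction (≤-trans (nonTrivial⇒n>1 p {{prime⇒nonTrivial pr}}) p≤0) λ ()
  step (suc zero) rec = 1 , ≤-refl , s≤s z≤n , λ p pr p≤1 → contradiction (≤-trans (nonTrivial⇒n>1 p {{prime⇒nonTrivial pr}}) p≤1) λ { (s≤s ()) }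
  step (suc (suc zero)) rec = 2 , s≤s z≤n , s≤s (s≤s z≤n) , λ p pr p≤2 → ∣-reflexive (≤-antisym p≤2 (nonTrivial⇒n>1 p {{prime⇒nonTrivial pr}}))
  step n@(suc (suc (suc m))) rec with Q , 1≤Q , Q≤ , primes ← rec (⌈n/2⌉<n (suc m)) =
    (n C x) * Q , *-mono-≤ 1≤C 1≤Q , (begin
      (n C x) * Q             ≤⟨ *-mono-≤ (C≤2^ n x) Q≤ ⟩
      2 ^ n * 8 ^ y           ≡⟨ cong (2 ^ n *_) (^-*-assoc 2 3 y) ⟩
      2 ^ n * 2 ^ (3 * y)     ≡⟨ ^-distribˡ-+-* 2 n (3 * y) ⟨
      2 ^ (n + 3 * y)         ≤⟨ ^-monoʳ-≤ 2 e≤ ⟩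
      2 ^ (3 * n)             ≡⟨ ^-*-assoc 2 3 n ⟨
      8 ^ n                   ∎) , prime∣
    where
    x = ⌊ n /2⌋
    y = ⌈ n /2⌉
    x+y : x + y ≡ n
    x+y = ⌊n/2⌋+⌈n/2⌉≡n n
    n!≡ : n ! ≡ (n C x) * (x ! * y !)
    n!≡ = subst (λ z → z ! ≡ (z C x) * (x ! * y !)) x+y (!≡C*!*! x y)
    1≤C : 1 ≤ n C x
    1≤C = n≢0⇒n>0 λ C≡0 → contradiction (trans n!≡ (cong (_* (x ! * y !)) C≡0)) (≢-nonZero⁻¹ (n !) {{n !≢0}})
    y≤2x : y ≤ x + x
    y≤2x = s≤s (≤-trans (s≤s (⌊n/2⌋-mono (n≤1+n m))) (m≤n+m x ⌊ suc m /2⌋))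
    r₁ : ∀ x y → x + y + 3 * y ≡ x + 3 * y + y
    r₁ = solve-∀
    r₂ : ∀ x y → x + 3 * y + (x + x) ≡ 3 * (x + y)
    r₂ = solve-∀
    -- The base 8 = 2³ comes from here: at n = 3 the halves are 1 and 2, and the exponent 3 gives
    -- equality.
    e≤ : n + 3 * y ≤ 3 * n
    e≤ = begin
      n + 3 * y             ≡⟨ cong (_+ 3 * y) x+y ⟨
      x + y + 3 * y         ≡⟨ r₁ x y ⟩
      x + 3 * y + y         ≤⟨ +-monoʳ-≤ (x + 3 * y) y≤2x ⟩
      x + 3 * y + (x + x)   ≡⟨ r₂ x y ⟩
      3 * (x + y)           ≡⟨ cong (3 *_) x+y ⟩
      3 * n                 ∎
    prime∣ : ∀ p → Prime p → p ≤ n → p ∣ (n C x) * Q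
    -- Matching a successor lets `p !` unfold, so `p` divides `p !` and hence `n !`. If `p` exceeds
    -- both halves it divides neither of their factorials, so it divides the binomial coefficient.
    prime∣ p@(suc _) pr p≤n with p ≤? y
    ... | yes p≤y = ∣n⇒∣m*n (n C x) (primes p pr p≤y)
    ... | no  p≰y with euclidsLemma (n C x) (x ! * y !) pr (subst (p ∣_) n!≡ (∣-trans (m∣m*n _) (m≤n⇒m!∣n! p≤n)))
    ... | inj₁ p∣C = ∣m⇒∣m*n Q p∣C
    ... | inj₂ p∣!! with euclidsLemma (x !) (y !) pr p∣!!
    ... | inj₁ p∣x! = contradiction (≤-trans (prime∣!⇒≤ pr x p∣x!) (⌊n/2⌋≤⌈n/2⌉ n)) p≰y
    ... | inj₂ p∣y! = contradiction (prime∣!⇒≤ pr y p∣y!) p≰y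

-- Common divisors within a short interval

gcd[y,uv]∣ : ∀ y u v → gcd y (u * v) ∣ gcd y u * gcd y v
-- The product of gcds is rewritten as gcd (gcd(y,u)·y, gcd(y,u)·v), and its second argument as gcd
-- (vy, vu).
gcd[y,uv]∣ y u v = subst (d ∣_) (sym (c*gcd[m,n]≡gcd[cm,cn] (gcd y u) y v))
  (gcd-greatest (∣n⇒∣m*n (gcd y u) d∣y)
    (subst (d ∣_) (trans (sym (c*gcd[m,n]≡gcd[cm,cn] v y u)) (*-comm v (gcd y u)))
      (gcd-greatest (∣n⇒∣m*n v d∣y) (subst (d ∣_) (*-comm u v) (gcd[m,n]∣n y (u * v))))))
  where
  d = gcd y (u * v)
  d∣y = gcd[m,n]∣m y (u * v)

gcd≢0ˡ : ∀ m n .{{_ : NonZero m}} → NonZero (gcd m n)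
gcd≢0ˡ m n = ≢-nonZero (gcd[m,n]≢0 m n (inj₁ (≢-nonZero⁻¹ m)))

-- When `Q` contains all primes of a + i, `gcd Q (a + i)` is a multiple of the radical of a + i. The
-- product therefore dominates the radicals, yet stays comparable to `Q`.
∏gcd : ℕ → ℕ → ℕ → ℕ
∏gcd Q a zero    = 1
∏gcd Q a (suc j) = ∏gcd Q a j * gcd Q (a + suc j)

-- A common divisor of a + m and a + i divides the nonzero difference m - i ≤ k, so each of the `j`
-- factors contributes at most `k`.
gcd[a+m,∏gcd]≤ : ∀ Q a k m j .{{_ : NonZero k}} → j < m → m ≤ k → gcd (a + m) (∏gcd Q a j) ≤ k ^ j
gcd[a+m,∏gcd]≤ Q a k m zero _ _ = ∣⇒≤ (gcd[m,n]∣n (a + m) 1)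
gcd[a+m,∏gcd]≤ Q a k m (suc j) j<m m≤k = begin
  gcd y (∏gcd Q a j * g)         ≤⟨ ∣⇒≤ {{m*n≢0 _ _ {{gcd≢0ˡ y (∏gcd Q a j)}} {{gcd≢0ˡ y g}}}} (gcd[y,uv]∣ y (∏gcd Q a j) g) ⟩
  gcd y (∏gcd Q a j) * gcd y g   ≤⟨ *-mono-≤ (gcd[a+m,∏gcd]≤ Q a k m j (<-trans (n<1+n j) j<m) m≤k) gcd≤k ⟩
  k ^ j * k                      ≡⟨ *-comm (k ^ j) k ⟩
  k ^ suc j                      ∎
  where
  y = a + m
  g = gcd Q (a + suc j)
  instance
    y≢0 : NonZero y
    y≢0 = >-nonZero (≤-trans (≤-trans (s≤s z≤n) j<m) (m≤n+m m a))
  e = m ∸ suc j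
  gcd∣e : gcd y g ∣ e
  gcd∣e = ∣m+n∣m⇒∣n {m = a + suc j}
    (subst (gcd y g ∣_) (trans (cong (λ z → a + z) (sym (m+[n∸m]≡n (<⇒≤ j<m)))) (sym (+-assoc a (suc j) e))) (gcd[m,n]∣m y g))
    (∣-trans (gcd[m,n]∣n y g) (gcd[m,n]∣n Q (a + suc j)))
  gcd≤k : gcd y g ≤ k
  gcd≤k = ≤-trans (∣⇒≤ {{>-nonZero (m<n⇒0<n∸m j<m)}} gcd∣e) (≤-trans (m∸n≤m m (suc j)) m≤k)

-- `Λ` is the lcm of the gcds, which still divides `Q`. Passing from product to lcm costs gcd(Λ, g)
-- at each step, and carrying `Λ ∣ ∏gcd Q a j` allows the preceding lemma to bound this cost by k^k.
∏gcd≤*^ : ∀ Q a k j .{{_ : NonZero k}} → j ≤ k →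
  ∃[ Λ ] Λ ∣ Q × Λ ∣ ∏gcd Q a j × ∏gcd Q a j ≤ Λ * k ^ (j * k)
∏gcd≤*^ Q a k zero _ = 1 , 1∣ Q , ∣-refl , ≤-refl
∏gcd≤*^ Q a k (suc j) j<k with Λ , Λ∣Q , Λ∣∏ , ∏≤ ← ∏gcd≤*^ Q a k j (<⇒≤ j<k) =
  lcm Λ g , lcm-least Λ∣Q (gcd[m,n]∣m Q y) , lcm-least (∣m⇒∣m*n g Λ∣∏) (n∣m*n (∏gcd Q a j)) , (begin
    ∏gcd Q a j * g                      ≤⟨ *-monoˡ-≤ g ∏≤ ⟩
    Λ * k ^ (j * k) * g                 ≡⟨ r₁ Λ (k ^ (j * k)) g ⟩
    Λ * g * k ^ (j * k)                 ≡⟨ cong (_* k ^ (j * k)) (gcd*lcm Λ g) ⟨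
    gcd Λ g * lcm Λ g * k ^ (j * k)     ≤⟨ *-monoˡ-≤ (k ^ (j * k)) (*-monoˡ-≤ (lcm Λ g) gcd≤) ⟩
    k ^ k * lcm Λ g * k ^ (j * k)       ≡⟨ r₂ (k ^ k) (lcm Λ g) (k ^ (j * k)) ⟩
    lcm Λ g * (k ^ k * k ^ (j * k))     ≡⟨ cong (lcm Λ g *_) (^-distribˡ-+-* k k (j * k)) ⟨
    lcm Λ g * k ^ (suc j * k)           ∎)
  where
  y = a + suc j
  g = gcd Q y
  r₁ : ∀ x y z → x * y * z ≡ x * z * y
  r₁ = solve-∀
  r₂ : ∀ x y z → x * y * z ≡ y * (x * z)
  r₂ = solve-∀
  instance
    y≢0 : NonZero y
    y≢0 = >-nonZero (m≤n⇒m≤o+n a (s≤s z≤n))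
  gcd≤ : gcd Λ g ≤ k ^ k
  gcd≤ = begin
    gcd Λ g                 ≤⟨ ∣⇒≤ {{gcd≢0ˡ y (∏gcd Q a j)}} (gcd-greatest (∣-trans (gcd[m,n]∣n Λ g) (gcd[m,n]∣n Q y)) (∣-trans (gcd[m,n]∣m Λ g) Λ∣∏)) ⟩
    gcd y (∏gcd Q a j)      ≤⟨ gcd[a+m,∏gcd]≤ Q a k (suc j) j ≤-refl j<k ⟩
    k ^ j                   ≤⟨ ^-monoʳ-≤ k (<⇒≤ j<k) ⟩
    k ^ k                   ∎

∏gcd≤ : ∀ Q a k j .{{_ : NonZero k}} .{{_ : NonZero Q}} → j ≤ k → ∏gcd Q a j ≤ Q * k ^ (k * k)
∏gcd≤ Q a k j j≤k with Λ , Λ∣Q , _ , ∏≤ ← ∏gcd≤*^ Q a k j j≤k =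
  ≤-trans ∏≤ (*-mono-≤ (∣⇒≤ Λ∣Q) (^-monoʳ-≤ k (*-monoˡ-≤ k j≤k)))

-- The abc inequality for consecutive integers

abc-consecutive : ExplicitABC → ∀ s → 1 ≤ s → suc s ^ 4 < rad (s * suc s) ^ 7
abc-consecutive abc s@(suc _) _ = subst (λ z → suc s ^ 4 < rad z ^ 7) abs≡
  (abc (ℤ.+ s) (ℤ.+ 1) (ℤ.+ suc s) (λ ()) (λ ()) (λ ())
    (coprime-sym (1-coprimeTo s)) (cong ℤ.+_ (+-comm s 1)) (ℤ.+<+ (s≤s z≤n)))
  where
  abs≡ : ℤ.∣ ℤ.+ s ℤ.* ℤ.+ 1 ℤ.* ℤ.+ suc s ∣ ≡ s * suc s
  abs≡ = trans (ℤ.abs-* (ℤ.+ s ℤ.* ℤ.+ 1) (ℤ.+ suc s))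
    (cong (_* suc s) (trans (ℤ.abs-* (ℤ.+ s) (ℤ.+ 1)) (*-identityʳ s)))

-- The radical of s(s+1) divides both `Q` and s(s+1), hence their gcd, and that gcd splits over the
-- two factors.
abc-consecutive-gcd : ExplicitABC → ∀ Q s .{{_ : NonZero Q}} → 1 ≤ s → (∀ p → Prime p → p ∣ s * suc s → p ∣ Q) →
  suc s ^ 4 ≤ (gcd Q s * gcd Q (suc s)) ^ 7
abc-consecutive-gcd abc Q s 1≤s primes = ≤-trans (<⇒≤ (abc-consecutive abc s 1≤s)) (^-monoˡ-≤ 7
  (∣⇒≤ {{m*n≢0 _ _ {{gcd≢0ˡ Q s}} {{gcd≢0ˡ Q (suc s)}}}}
    (∣-trans (gcd-greatest (rad∣ (s * suc s) Q primes) (rad∣ (s * suc s) (s * suc s) λ _ _ p∣ → p∣)) (gcd[y,uv]∣ Q s (suc s)))))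

-- The numbers a+1, ..., a+2h form `h` disjoint consecutive pairs. Each pair contributes a^4 on the
-- left, and each gcd enters the product exactly once.
abc⇒^≤∏gcd : ExplicitABC → ∀ Q a h .{{_ : NonZero Q}} →
  (∀ i → 1 ≤ i → i ≤ h + h → ∀ p → Prime p → p ∣ a + i → p ∣ Q) → (a ^ 4) ^ h ≤ ∏gcd Q a (h + h) ^ 7
abc⇒^≤∏gcd abc Q a zero    _ = ≤-refl
abc⇒^≤∏gcd abc Q a (suc h) primes = begin
  a ^ 4 * (a ^ 4) ^ h                               ≡⟨ *-comm (a ^ 4) _ ⟩
  (a ^ 4) ^ h * a ^ 4                               ≤⟨ *-mono-≤ (abc⇒^≤∏gcd abc Q a h λ i 1≤i i≤ → primes i 1≤i (≤-trans i≤ 2h≤)) pair ⟩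
  ∏gcd Q a (h + h) ^ 7 * (gcd Q s * gcd Q s′) ^ 7   ≡⟨ ^-distribʳ-* (∏gcd Q a (h + h)) (gcd Q s * gcd Q s′) 7 ⟨
  (∏gcd Q a (h + h) * (gcd Q s * gcd Q s′)) ^ 7     ≡⟨ cong (_^ 7) (*-assoc (∏gcd Q a (h + h)) (gcd Q s) (gcd Q s′)) ⟨
  ∏gcd Q a (suc (suc (h + h))) ^ 7                  ≡⟨ cong (λ z → ∏gcd Q a z ^ 7) 2h≡ ⟩
  ∏gcd Q a (suc h + suc h) ^ 7                      ∎
  where
  s = a + suc (h + h)
  s′ = a + suc (suc (h + h))
  2h≡ : suc (suc (h + h)) ≡ suc h + suc h
  2h≡ = cong suc (sym (+-suc h h))
  2h≤ : h + h ≤ suc h + suc h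
  2h≤ = +-mono-≤ (n≤1+n h) (n≤1+n h)
  s′≡ : suc s ≡ s′
  s′≡ = sym (+-suc a (suc (h + h)))
  primes′ : ∀ p → Prime p → p ∣ s * suc s → p ∣ Q
  primes′ p pr p∣ with euclidsLemma s (suc s) pr p∣
  ... | inj₁ p∣s  = primes (suc (h + h)) (s≤s z≤n) (≤-trans (n≤1+n _) (≤-reflexive 2h≡)) p pr p∣s
  ... | inj₂ p∣s′ = primes (suc (suc (h + h))) (s≤s z≤n) (≤-reflexive 2h≡) p pr (subst (p ∣_) s′≡ p∣s′)
  pair : a ^ 4 ≤ (gcd Q s * gcd Q s′) ^ 7
  pair = begin
    a ^ 4                          ≤⟨ ^-monoˡ-≤ 4 (≤-trans (m≤m+n a _) (n≤1+n s)) ⟩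
    suc s ^ 4                      ≤⟨ abc-consecutive-gcd abc Q s (m≤n⇒m≤o+n a (s≤s z≤n)) primes′ ⟩
    (gcd Q s * gcd Q (suc s)) ^ 7  ≡⟨ cong (λ z → (gcd Q s * gcd Q z) ^ 7) s′≡ ⟩
    (gcd Q s * gcd Q s′) ^ 7       ∎

-- `Q` is taken as the multiple of all primes up to `A`: 8^A bounds `Q` itself, and k^(k·k) pays for
-- the divisors shared between terms.
abc⇒radical-bound : ExplicitABC → ∀ a k h A .{{_ : NonZero k}} → h + h ≤ k →
  (∀ i → 1 ≤ i → i ≤ k → ∀ p → Prime p → p ∣ a + i → p ≤ A) →
  (a ^ 4) ^ h ≤ (8 ^ A * k ^ (k * k)) ^ 7
abc⇒radical-bound abc a k h A 2h≤k smooth with Q , 1≤Q , Q≤ , primes ← multipleOfPrimes≤ A = begin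
  (a ^ 4) ^ h                  ≤⟨ abc⇒^≤∏gcd abc Q a h (λ i 1≤i i≤ p pr p∣ → primes p pr (smooth i 1≤i (≤-trans i≤ 2h≤k) p pr p∣)) ⟩
  ∏gcd Q a (h + h) ^ 7         ≤⟨ ^-monoˡ-≤ 7 (∏gcd≤ Q a k (h + h) 2h≤k) ⟩
  (Q * k ^ (k * k)) ^ 7        ≤⟨ ^-monoˡ-≤ 7 (*-monoˡ-≤ (k ^ (k * k)) Q≤) ⟩
  (8 ^ A * k ^ (k * k)) ^ 7    ∎
  where instance _ = >-nonZero 1≤Q

-- Solutions of the factorial equation

log₂-bracket : ∀ n → 1 ≤ n → ∃[ l ] n < 2 ^ l × 2 ^ l ≤ 2 * n
log₂-bracket (suc zero)    _ = 1 , ≤-refl , ≤-refl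
log₂-bracket (suc n@(suc _)) _ with l , n< , ≤2n ← log₂-bracket n (s≤s z≤n) with m≤n⇒m<n∨m≡n n<
... | inj₁ 1+n< = l , 1+n< , ≤-trans ≤2n (*-monoʳ-≤ 2 (n≤1+n n))
... | inj₂ 1+n≡ = suc l , subst (λ z → suc n < 2 * z) 1+n≡ (m<m+n (suc n) (s≤s z≤n)) , ≤-reflexive (cong (2 *_) (sym 1+n≡))

maximum : ∀ (P : ℕ → Set) b bs → All P (b ∷ bs) → ∃[ A ] P A × A ∈ b ∷ bs × All (_≤ A) (b ∷ bs)
maximum P b [] (Pb ∷ []) = b , Pb , here refl , ≤-refl ∷ []
maximum P b (b′ ∷ bs) (Pb ∷ Pbs) with A , PA , A∈ , bs≤A ← maximum P b′ bs Pbs with ≤-total b A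
... | inj₁ b≤A = A , PA , there A∈ , b≤A ∷ bs≤A
... | inj₂ A≤b = b , Pb , here refl , ≤-refl ∷ All.map (λ x≤A → ≤-trans x≤A A≤b) bs≤A

∈⇒≤sum : ∀ {x xs} → x ∈ xs → x ≤ sum xs
∈⇒≤sum {xs = _ ∷ xs} (here refl) = m≤m+n _ (sum xs)
∈⇒≤sum {xs = y ∷ _}  (there x∈)  = m≤n⇒m≤o+n y (∈⇒≤sum x∈)

∈⇒!≤∏! : ∀ {x xs} → x ∈ xs → x ! ≤ ∏! xs
∈⇒!≤∏! {xs = xs} x∈ = ∈⇒≤product (All.map⁺ (All.universal _!≢0 xs)) (∈-map⁺ _! x∈)

prime∣∏!⇒≤ : ∀ {p A} → Prime p → ∀ bs → All (_≤ A) bs → p ∣ ∏! bs → p ≤ A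
prime∣∏!⇒≤ pr [] _ p∣1 = contradiction (subst Prime (∣1⇒≡1 p∣1) pr) ¬prime[1]
prime∣∏!⇒≤ pr (b ∷ bs) (b≤A ∷ bs≤A) p∣ with euclidsLemma (b !) (∏! bs) pr p∣
... | inj₁ p∣b! = ≤-trans (prime∣!⇒≤ pr b p∣b!) b≤A
... | inj₂ p∣∏  = prime∣∏!⇒≤ pr bs bs≤A p∣∏

-- The witness is ⌊k/2⌋, the number of disjoint pairs to which abc is applied; k = 3 is the tight
-- case of the last inequality.
half-bounds : ∀ k → 2 ≤ k → ∃[ h ] 1 ≤ h × 2 * h ≤ k × k ≤ 3 * h
half-bounds k 2≤k with halve k
half-bounds _ () | zero , inj₁ refl
half-bounds _ (s≤s ()) | zero , inj₂ refl
... | h@(suc _) , inj₁ refl = h , s≤s z≤n , ≤-reflexive (cong (h +_) (+-identityʳ h)) , +-monoʳ-≤ h (m≤m+n h _)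
... | h@(suc h′) , inj₂ refl = h , s≤s z≤n , ≤-trans (≤-reflexive (cong (h +_) (+-identityʳ h))) (n≤1+n _) ,
  (begin
    suc (h + h)       ≡⟨ +-comm 1 (h + h) ⟩
    h + h + 1         ≤⟨ +-monoʳ-≤ (h + h) (s≤s z≤n) ⟩
    h + h + h         ≡⟨ r h ⟩
    3 * h             ∎)
  where
  r : ∀ h → h + h + h ≡ 3 * h
  r = solve-∀

cancel-factorials : ∀ a k b j bs → ∏! (a ∷ b ∷ bs) ≡ ∏! (a + k ∷ b + j ∷ []) → rising a k * rising b j ≡ ∏! bs
cancel-factorials a k b j bs eq = *-cancelˡ-≡ _ _ (a ! * b !) {{a !* b !≢0}} (begin-equality
  a ! * b ! * (rising a k * rising b j)     ≡⟨ r (a !) (b !) (rising a k) (rising b j) ⟩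
  a ! * rising a k * (b ! * rising b j * 1) ≡⟨ cong₂ (λ x y → x * (y * 1)) (!*rising a k) (!*rising b j) ⟩
  ∏! (a + k ∷ b + j ∷ [])                   ≡⟨ eq ⟨
  a ! * (b ! * ∏! bs)                       ≡⟨ *-assoc (a !) (b !) (∏! bs) ⟨
  a ! * b ! * ∏! bs                         ∎)
  where
  r : ∀ a b x y → a * b * (x * y) ≡ a * x * (b * y * 1)
  r = solve-∀

-- Splitting off `d` ensures that the remaining entries have a maximum `A`. The facts collected in
-- `bound` are the hypotheses of `LogBound`, and L ≤ L₀ gives a + k < 2^L ≤ 2^L₀.
factorial-product-bound : ExplicitABC → ∀ t c → ∃[ B ] ∀ a k b j d bs → length (a ∷ b ∷ d ∷ bs) ≡ t →
  2 ≤ k → j ≤ c * k → b + j ≤ a + k → b ≤ a → All (λ x → 1 ≤ x × x ≤ a) (d ∷ bs) →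
  ∏! (a ∷ b ∷ d ∷ bs) ≡ ∏! (a + k ∷ b + j ∷ []) → a + k ≤ B
factorial-product-bound abc t c with L₀ , logBound ← log-bound t c = 2 ^ L₀ , bound
  where
  bound : ∀ a k b j d bs → length (a ∷ b ∷ d ∷ bs) ≡ t →
    2 ≤ k → j ≤ c * k → b + j ≤ a + k → b ≤ a → All (λ x → 1 ≤ x × x ≤ a) (d ∷ bs) →
    ∏! (a ∷ b ∷ d ∷ bs) ≡ ∏! (a + k ∷ b + j ∷ []) → a + k ≤ 2 ^ L₀
  bound a k b j d ds refl 2≤k j≤ck m≤n b≤a bs-bounds eq
    with L , n<2^L , 2^L≤2n ← log₂-bracket (a + k) (≤-trans (≤-trans (s≤s z≤n) 2≤k) (m≤n+m k a))
    with h , 1≤h , 2h≤k , k≤3h ← half-bounds k 2≤k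
    with A , (1≤A , A≤a) , A∈ , bs≤A ← maximum _ d ds bs-bounds =
    ≤-trans (<⇒≤ n<2^L) (^-monoʳ-≤ 2 (logBound n a k h A L A≢0 1≤h refl 2h≤k k≤3h n<2^L 2^L≤2n
      P≤ A≤a A≤ A!≤ (abc⇒radical-bound abc a k h A (≤-trans (≤-reflexive (cong (h +_) (sym (+-identityʳ h)))) 2h≤k) smooth)))
    where
    n = a + k
    bs = d ∷ ds
    A≢0 : NonZero A
    A≢0 = >-nonZero 1≤A
    instance
      k≢0 : NonZero k
      k≢0 = >-nonZero (≤-trans (s≤s z≤n) 2≤k)
      n≢0 : NonZero n
      n≢0 = >-nonZero (≤-trans (≤-trans (s≤s z≤n) 2≤k) (m≤n+m k a))
    a<2^L : a < 2 ^ L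
    a<2^L = ≤-<-trans (m≤m+n a k) n<2^L
    PR≡ : rising a k * rising b j ≡ ∏! bs
    PR≡ = cancel-factorials a k b j bs eq
    r₁ : ∀ a b k j s → a + k + (b + j + 0) + s ≡ a + (b + (j + (k + s)))
    r₁ = solve-∀
    -- `sum-comparison` loses one `L` for each of the `t` entries on the left; `a` and `b` then
    -- cancel from both sides.
    Σ≤ : sum bs ≤ j + (k + t * L)
    Σ≤ = +-cancelˡ-≤ b _ _ (+-cancelˡ-≤ a _ _ (≤-trans
      (sum-comparison L (a ∷ b ∷ bs) (n ∷ b + j ∷ [])
        (a<2^L ∷ ≤-<-trans b≤a a<2^L ∷ All.map (λ x → ≤-<-trans (proj₂ x) a<2^L) bs-bounds)
        (n<2^L ∷ ≤-<-trans m≤n n<2^L ∷ []) eq)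
      (≤-reflexive (r₁ a b k j (t * L)))))
    -- Merging with budget `j` produces `j !`, which is at most `rising b j` and so cancels against
    -- the second rising product.
    P≤ : rising a k ≤ A ^ (k + t * L)
    P≤ = *-cancelˡ-≤ (j !) {{j !≢0}} (begin
      j ! * rising a k             ≡⟨ *-comm (j !) _ ⟩
      rising a k * j !             ≤⟨ *-monoʳ-≤ (rising a k) (!≤rising b j) ⟩
      rising a k * rising b j      ≡⟨ PR≡ ⟩
      ∏! bs                        ≤⟨ ∏!≤!*^ bs j A (k + t * L) bs≤A Σ≤ {{A≢0}} ⟩
      j ! * A ^ (k + t * L)        ∎)
    A≤ : A ≤ suc c * k + t * L
    A≤ = begin
      A                        ≤⟨ ∈⇒≤sum A∈ ⟩
      sum bs                   ≤⟨ Σ≤ ⟩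
      j + (k + t * L)          ≤⟨ +-monoˡ-≤ (k + t * L) j≤ck ⟩
      c * k + (k + t * L)      ≡⟨ +-assoc (c * k) k (t * L) ⟨
      c * k + k + t * L        ≡⟨ cong (_+ t * L) (+-comm (c * k) k) ⟩
      suc c * k + t * L        ∎
    A!≤ : A ! ≤ n ^ (suc c * k)
    A!≤ = begin
      A !                      ≤⟨ ∈⇒!≤∏! A∈ ⟩
      ∏! bs                    ≡⟨ PR≡ ⟨
      rising a k * rising b j  ≤⟨ *-mono-≤ (rising≤^ a k n ≤-refl) (rising≤^ b j n m≤n) ⟩
      n ^ k * n ^ j            ≤⟨ *-monoʳ-≤ (n ^ k) (^-monoʳ-≤ n j≤ck) ⟩
      n ^ k * n ^ (c * k)      ≡⟨ ^-distribˡ-+-* n k (c * k) ⟨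
      n ^ (suc c * k)          ∎
    smooth : ∀ i → 1 ≤ i → i ≤ k → ∀ p → Prime p → p ∣ a + i → p ≤ A
    smooth i 1≤i i≤k p pr p∣ = prime∣∏!⇒≤ pr bs bs≤A
      (subst (p ∣_) PR≡ (∣m⇒∣m*n (rising b j) (∣-trans p∣ (∣rising a k i 1≤i i≤k))))

-- Passing from tuples to lists

values : ℕ → (ℕ → ℕ) → List ℕ
values zero    a = []
values (suc t) a = a 1 ∷ values t (a ∘ suc)

length-values : ∀ t a → length (values t a) ≡ t
length-values zero    a = refl
length-values (suc t) a = cong suc (length-values t (a ∘ suc))

prodFrom1-suc : ∀ t f → prodFrom1 (suc t) f ≡ f 1 * prodFrom1 t (f ∘ suc)
prodFrom1-suc zero    f = *-comm 1 (f 1)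
prodFrom1-suc (suc t) f = trans (cong (_* f (suc (suc t))) (prodFrom1-suc t f)) (*-assoc (f 1) _ _)

prodFrom1-! : ∀ t a → prodFrom1 t (λ l → a l !) ≡ ∏! (values t a)
prodFrom1-! zero    a = refl
prodFrom1-! (suc t) a = trans (prodFrom1-suc t (λ l → a l !)) (cong (a 1 ! *_) (prodFrom1-! t (a ∘ suc)))

∈-values : ∀ t a i → 1 ≤ i → i ≤ t → a i ∈ values t a
∈-values (suc t) a (suc zero)    _ _         = here refl
∈-values (suc t) a (suc (suc i)) _ (s≤s i≤t) = there (∈-values t (a ∘ suc) (suc i) (s≤s z≤n) i≤t)

All-values : ∀ {P : ℕ → Set} t a → (∀ l → 1 ≤ l → l ≤ t → P (a l)) → All P (values t a)
All-values zero    a h = []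
All-values (suc t) a h = h 1 ≤-refl (s≤s z≤n) ∷ All-values t (a ∘ suc) λ l 1≤l l≤t → h (suc l) (s≤s z≤n) (s≤s l≤t)

antitone : ∀ t (a : ℕ → ℕ) → (∀ l → 1 ≤ l → l < t → a (suc l) ≤ a l) → ∀ l d → 1 ≤ l → l + d ≤ t → a (l + d) ≤ a l
antitone t a step l zero    1≤l _ = ≤-reflexive (cong a (+-identityʳ l))
antitone t a step l (suc d) 1≤l l+d≤t = begin
  a (l + suc d)  ≡⟨ cong a (+-suc l d) ⟩
  a (suc (l + d)) ≤⟨ step (l + d) (≤-trans 1≤l (m≤m+n l d)) l+d<t ⟩
  a (l + d)      ≤⟨ antitone t a step l d 1≤l (<⇒≤ l+d<t) ⟩
  a l            ∎
  where
  l+d<t : l + d < t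
  l+d<t = subst (_≤ t) (+-suc l d) l+d≤t

antitone-≤ : ∀ t (a : ℕ → ℕ) → (∀ l → 1 ≤ l → l < t → a (suc l) ≤ a l) → ∀ l m → 1 ≤ l → l ≤ m → m ≤ t → a m ≤ a l
antitone-≤ t a step l m 1≤l l≤m m≤t = subst (λ z → a z ≤ a l) eq
  (antitone t a step l (m ∸ l) 1≤l (≤-trans (≤-reflexive eq) m≤t))
  where
  eq : l + (m ∸ l) ≡ m
  eq = m+[n∸m]≡n l≤m

absDiff-suc : ∀ n → absDiff n (suc n) ≡ 1
absDiff-suc n = cong₂ _+_ (m≤n⇒m∸n≡0 (n≤1+n n)) (m+n∸n≡m 1 n)

-- The list bound does not depend on which entry is paired with `n₂`, so a single `B` serves every
-- `i`; every coordinate is then at most n₁ ≤ B.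
InN-bounded : ExplicitABC → ∀ t c → 3 ≤ t →
  ∃[ B ] ∀ i → 2 ≤ i → i ≤ t → ∀ a n₁ n₂ → InN c t i a n₁ n₂ → BoundedBy t B a n₁ n₂
InN-bounded abc t@(suc t′) c (s≤s 2≤t′) with B , core ← factorial-product-bound abc t c = B , bounded
  where
  bounded : ∀ i → 2 ≤ i → i ≤ t → ∀ a n₁ n₂ → InN c t i a n₁ n₂ → BoundedBy t B a n₁ n₂
  bounded (suc i) (s≤s 1≤i) (s≤s i≤t′) a n₁ n₂
    ((step , 2≤aₜ , n₂≤n₁ , _ , _ , eq) , nontriv , a₁<n₁ , aᵢ<n₂ , k₂≤)
    with ys , zs , split ← ∈-∃++ (∈-values t′ (a ∘ suc) i 1≤i i≤t′) =
    (λ l 1≤l l≤t → ≤-trans (≤a₁ l 1≤l l≤t) (≤-trans (<⇒≤ a₁<n₁) n₁≤B)) , n₁≤B , ≤-trans n₂≤n₁ n₁≤B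
    where
    ≤a₁ : ∀ l → 1 ≤ l → l ≤ t → a l ≤ a 1
    ≤a₁ l 1≤l l≤t = antitone-≤ t a step 1 l ≤-refl 1≤l l≤t
    b = a (suc i)
    k = n₁ ∸ a 1
    j = n₂ ∸ b
    a₁+k : a 1 + k ≡ n₁
    a₁+k = m+[n∸m]≡n (<⇒≤ a₁<n₁)
    b+j : b + j ≡ n₂
    b+j = m+[n∸m]≡n (<⇒≤ aᵢ<n₂)
    2≤k : 2 ≤ k
    -- Nontriviality at l = 1 excludes n₁ = a₁ + 1.
    2≤k = +-cancelˡ-≤ (a 1) 2 k (≤-trans (≤-reflexive (+-comm (a 1) 2)) (≤-trans a₁+2≤n₁ (≤-reflexive (sym a₁+k))))
      where
      a₁+2≤n₁ : suc (suc (a 1)) ≤ n₁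
      a₁+2≤n₁ = ≤∧≢⇒< a₁<n₁ λ 1+a≡n → proj₁ (nontriv 1 ≤-refl (s≤s z≤n)) (trans (cong (absDiff (a 1)) (sym 1+a≡n)) (absDiff-suc (a 1)))
    -- The chosen entry moves to the front of the tail, to be paired with `n₂`.
    perm : values t′ (a ∘ suc) ↭ b ∷ ys ++ zs
    perm = subst (_↭ b ∷ ys ++ zs) (sym split) (shift b ys zs)
    eq′ : ∏! (a 1 ∷ b ∷ ys ++ zs) ≡ ∏! (a 1 + k ∷ b + j ∷ [])
    eq′ = begin-equality
      a 1 ! * ∏! (b ∷ ys ++ zs)              ≡⟨ cong (a 1 ! *_) (product-↭ (map⁺ _! perm)) ⟨
      ∏! (values t a)                        ≡⟨ prodFrom1-! t a ⟨
      prodFrom1 t (λ l → a l !)              ≡⟨ eq ⟩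
      n₁ ! * n₂ !                            ≡⟨ cong₂ (λ x y → x ! * y !) a₁+k b+j ⟨
      (a 1 + k) ! * (b + j) !                ≡⟨ cong ((a 1 + k) ! *_) (*-identityʳ _) ⟨
      ∏! (a 1 + k ∷ b + j ∷ [])              ∎
    len : length (a 1 ∷ b ∷ ys ++ zs) ≡ t
    len = cong suc (trans (sym (↭-length perm)) (length-values t′ (a ∘ suc)))
    bounds : All (λ x → 1 ≤ x × x ≤ a 1) (ys ++ zs)
    bounds = All.tail (All-resp-↭ perm (All-values t′ (a ∘ suc) λ l 1≤l l≤t′ →
      ≤-trans (≤-trans (s≤s z≤n) 2≤aₜ) (antitone-≤ t a step (suc l) t (s≤s z≤n) (s≤s l≤t′) ≤-refl) , ≤a₁ (suc l) (s≤s z≤n) (s≤s l≤t′)))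
    apply-core : ∀ ds → length (a 1 ∷ b ∷ ds) ≡ t → All (λ x → 1 ≤ x × x ≤ a 1) ds →
      ∏! (a 1 ∷ b ∷ ds) ≡ ∏! (a 1 + k ∷ b + j ∷ []) → a 1 + k ≤ B
    -- An empty remainder would mean t = 2.
    apply-core []       refl _ _ = contradiction 2≤t′ λ { (s≤s ()) }
    apply-core (d ∷ ds) len bnd e = core (a 1) k b j d ds len 2≤k k₂≤
      (≤-trans (≤-reflexive b+j) (≤-trans n₂≤n₁ (≤-reflexive (sym a₁+k)))) (≤a₁ (suc i) (s≤s z≤n) (s≤s i≤t′)) bnd e
    n₁≤B : n₁ ≤ B
    n₁≤B = subst (_≤ B) a₁+k (apply-core (ys ++ zs) len bounds eq′)

theorem1p1 : ExplicitABC → (t c : ℕ) → 3 ≤ t → 1 ≤ c →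
    ((i : ℕ) → 2 ≤ i → i ≤ t → ∃[ B ] ∀ a n₁ n₂ → InN c t i a n₁ n₂ → BoundedBy t B a n₁ n₂)
    × (∃[ B ] ∀ i → 2 ≤ i → i ≤ t → ∀ a n₁ n₂ → InN c t i a n₁ n₂ → BoundedBy t B a n₁ n₂)
theorem1p1 abc t c 3≤t _ with B , bounded ← InN-bounded abc t c 3≤t =
  (λ i 2≤i i≤t → B , bounded i 2≤i i≤t) , B , bounded
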